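{- There exists a parallel matrix multiplication algorithm that multiplies two $n\times n$ matrices (over a field $\mathbb{F}$ in which field operations take $O(1)$ work) with $O\left(n^{2.373}\right)$ work and $O(\log n)$ depth, using $O\left(n^{2.373}\right)$ space.
   Context: Computation is in the work-depth model: work is the total number of (field) operations, depth is the longest chain of sequential dependencies. The algorithm is based on the tensor-based matrix multiplication algorithms of Vassilevska Williams (2012) and Le Gall (2014), whose known result may be used: the exponent of matrix multiplication satisfies $\omega<2.373$; equivalently, there are fixed integers $q\ge2$ and $r$ such that the rank of the matrix multiplication tensor $\langle q,q,q\rangle=\sum_{i,j,k\in[q]}x_{ij}y_{jk}z_{ki}$ is at most $r$ and $\log_q r\le 2.373$. -}

module Defs where

open import Algebra.Apartness.Bundles using (HeytingField; HeytingCommutativeRing)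
open import Algebra.Bundles using (CommutativeRing)
import Algebra.Properties.CommutativeMonoid.Sum as Sum
open import Data.Fin.Base using (Fin)
open import Data.Fin.Properties using (_≟_)
open import Data.List.Base using (List; []; _∷_; length)
open import Data.List.Membership.Propositional using (_∈_)
open import Data.List.Relation.Binary.Sublist.Propositional using (_⊆_)
open import Data.List.Relation.Unary.Linked using (Linked)
open import Data.Nat.Base as ℕ using (ℕ; _≤_; _^_)
open import Data.Nat.Logarithm using (⌊log₂_⌋)
open import Data.Product.Base using (_×_; _,_; ∃-syntax)
open import Data.Sum.Base using (_⊎_)
open import Level using (Level; _⊔_)
open import Relation.Binary.PropositionalEquality.Core using (_≡_; _≢_)
open import Relation.Nullary.Decidable.Core using (yes; no)

-- f(n) = O(n^(a/b)), i.e. f(n) ≤ C · n^(a/b) for all large n, with both sides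
-- raised to the power b > 0 so that the exponents are natural numbers.
_∈O[n^_/_] : (ℕ → ℕ) → ℕ → ℕ → Set
f ∈O[n^ a / b ] = ∃[ C ] ∃[ N ] (∀ n → N ≤ n → f n ^ b ≤ C ^ b ℕ.* n ^ a)

_∈O[log-n] : (ℕ → ℕ) → Set
f ∈O[log-n] = ∃[ C ] ∃[ N ] (∀ n → N ≤ n → f n ≤ C ℕ.* ⌊log₂ n ⌋)

-- log_q r ≤ a/b, for q ≥ 2 and b > 0: equivalent to r ≤ q^(a/b).
log[_]_≤_/_ : ℕ → ℕ → ℕ → ℕ → Set
log[ q ] r ≤ a / b = r ^ b ≤ q ^ a

-- The memory of a program for n × n matrices: the two operands start in the
-- cells `matA` and `matB`, the product is left in the cells `matC`, and there
-- are `t` further cells.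
data Cell (n t : ℕ) : Set where
  matA matB matC : (i j : Fin n) → Cell n t
  temp           : Fin t → Cell n t

-- `const` refers to one of κ field elements hard-wired into the algorithm.
data Operation (κ n t : ℕ) : Set where
  const           : Fin κ → Operation κ n t
  add sub mul div : (x y : Cell n t) → Operation κ n t

record Instruction (κ n t : ℕ) : Set where
  constructor _≔_
  field
    target    : Cell n t
    operation : Operation κ n t

open Instruction public

Program : ℕ → ℕ → ℕ → Set
Program κ n t = List (Instruction κ n t)

reads : ∀ {κ n t} → Operation κ n t → List (Cell n t)
reads (const _) = []
reads (add x y) = x ∷ y ∷ []
reads (sub x y) = x ∷ y ∷ []
reads (mul x y) = x ∷ y ∷ []
reads (div x y) = x ∷ y ∷ []

-- For an instruction I preceding an instruction J in a program: J has to wait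
-- for I if it uses the result of I, overwrites that result, or overwrites an
-- operand of I.  Instructions not linked by a chain of such dependencies may
-- be executed in parallel.
_Precedes_ : ∀ {κ n t} → Instruction κ n t → Instruction κ n t → Set
I Precedes J = (target I ∈ reads (operation J))
             ⊎ (target I ≡ target J)
             ⊎ (target J ∈ reads (operation I))

-- The longest chain of sequential dependencies has at most d instructions.
Depth≤ : ∀ {κ n t} → Program κ n t → ℕ → Set
Depth≤ p d = ∀ {chain} → chain ⊆ p → Linked _Precedes_ chain → length chain ≤ d

-- One program per matrix size; the number of hard-wired constants does not
-- depend on the size.
record ParallelAlgorithm : Set where
  field
    constants   : ℕ
    temporaries : ℕ → ℕ
    program     : ∀ n → Program constants n (temporaries n)

  work : ℕ → ℕ
  work n = length (program n)

  space : ℕ → ℕ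
  space n = 3 ℕ.* (n ℕ.* n) ℕ.+ temporaries n

  HasDepthBound : (ℕ → ℕ) → Set
  HasDepthBound d = ∀ n → Depth≤ (program n) (d n)

module OverField {c ℓ₁ ℓ₂ : Level} (F : HeytingField c ℓ₁ ℓ₂) where

  open HeytingField F using (Carrier; _≈_; _#_; _+_; _-_; _*_; 0#; 1#)
  open CommutativeRing
    (HeytingCommutativeRing.commutativeRing (HeytingField.heytingCommutativeRing F))
    using (+-commutativeMonoid)
  open Sum +-commutativeMonoid using (sum)

  Tensor : Set → Set → Set → Set c
  Tensor X Y Z = X → Y → Z → Carrier

  -- The rank of T is at most r: T is a sum of r rank-one tensors u ⊗ v ⊗ w.
  Rank≤ : ∀ {X Y Z} → Tensor X Y Z → ℕ → Set (c ⊔ ℓ₁)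
  Rank≤ {X} {Y} {Z} T r =
    ∃[ u ] ∃[ v ] ∃[ w ] (∀ x y z → T x y z ≈ sum (rankOne u v w x y z))
    where
    rankOne : (Fin r → X → Carrier) → (Fin r → Y → Carrier) → (Fin r → Z → Carrier) →
              X → Y → Z → Fin r → Carrier
    rankOne u v w x y z l = u l x * v l y * w l z

  δ : ∀ {q} → Fin q → Fin q → Carrier
  δ i j with i ≟ j
  ... | yes _ = 1#
  ... | no  _ = 0#

  -- ⟨q,q,q⟩ = Σ_{i,j,k} x_ij y_jk z_ki, given by its coefficients at
  -- x_(i,j) y_(j′,k) z_(k′,i′).
  ⟨_,_,_⟩ : ∀ m n p → Tensor (Fin m × Fin n) (Fin n × Fin p) (Fin p × Fin m)
  ⟨ m , n , p ⟩ (i , j) (j′ , k) (k′ , i′) = δ i i′ * δ j j′ * δ k k′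

  Matrix : ℕ → Set c
  Matrix n = Fin n → Fin n → Carrier

  _·_ : ∀ {n} → Matrix n → Matrix n → Matrix n
  (A · B) i j = sum (λ k → A i k * B k j)

  Memory : ℕ → ℕ → Set c
  Memory n t = Cell n t → Carrier

  -- A relation rather than a function, because division is partial.
  data Value {κ n t} (γ : Fin κ → Carrier) (μ : Memory n t) :
             Operation κ n t → Carrier → Set (c ⊔ ℓ₁ ⊔ ℓ₂) where
    const : ∀ {a v}   → v ≈ γ a                     → Value γ μ (const a) v
    add   : ∀ {x y v} → v ≈ μ x + μ y               → Value γ μ (add x y) v
    sub   : ∀ {x y v} → v ≈ μ x - μ y               → Value γ μ (sub x y) v
    mul   : ∀ {x y v} → v ≈ μ x * μ y               → Value γ μ (mul x y) v
    div   : ∀ {x y v} → μ y # 0# → v * μ y ≈ μ x    → Value γ μ (div x y) v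

  -- One instruction stores the value in its target and changes no other cell.
  record Step {κ n t} (γ : Fin κ → Carrier) (I : Instruction κ n t)
              (μ ν : Memory n t) : Set (c ⊔ ℓ₁ ⊔ ℓ₂) where
    field
      written   : Value γ μ (operation I) (ν (target I))
      unchanged : ∀ x → x ≢ target I → ν x ≈ μ x

  data Run {κ n t} (γ : Fin κ → Carrier) :
           Program κ n t → (μ ν : Memory n t) → Set (c ⊔ ℓ₁ ⊔ ℓ₂) where
    []  : ∀ {μ ν} → (∀ x → ν x ≈ μ x) → Run γ [] μ ν
    _∷_ : ∀ {I p μ ν ξ} → Step γ I μ ν → Run γ p ν ξ → Run γ (I ∷ p) μ ξ

  -- The initial contents of the cells `matC` and `temp` are arbitrary.  The
  -- final memory is unique up to ≈, so asking for one successful run suffices.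
  MultipliesMatrices : ParallelAlgorithm → Set (c ⊔ ℓ₁ ⊔ ℓ₂)
  MultipliesMatrices alg =
    ∃[ γ ] (∀ n (A B : Matrix n) (μ : Memory n (temporaries n)) →
            (∀ i j → μ (matA i j) ≈ A i j) →
            (∀ i j → μ (matB i j) ≈ B i j) →
            ∃[ ν ] (Run {constants} γ (program n) μ ν ×
                    (∀ i j → ν (matC i j) ≈ (A · B) i j)))
    where open ParallelAlgorithm alg

{-# OPTIONS --safe #-}

-- A rank-r decomposition of ⟨q,q,q⟩ reduces the product of q^(m+1) × q^(m+1)
-- matrices to r products of q^m × q^m matrices, whose factors and whose
-- results enter through linear combinations of q² respectively r blocks.
-- Unrolled over all k levels, every level is a bounded number of phases of
-- independent instructions, so that the depth is O(k) = O(log n), while the work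
-- of the levels is the geometric sum Σ r^i q^(2(k-i)), which is O(r^k) once
-- r > q².  The rank bound may be raised to q² + 1 because q² + 1 ≤ q^2.373 for
-- q ≥ 2.  Finally n × n matrices are padded to the least suitable power of q,
-- and q^k ≤ q n gives r^k ≤ (q^k)^2.373 = O(n^2.373).

module Submission where

open import Defs
open import Algebra.Apartness.Bundles using (HeytingField)
open import Data.Nat.Base using (ℕ; _≤_)
open import Data.Product.Base using (_×_; ∃-syntax)
open import Level using (Level)

open import Algebra.Apartness.Bundles using (HeytingCommutativeRing)
open import Algebra.Bundles using (CommutativeRing)
import Algebra.Properties.Semiring.Sum as SemiringSum
import Algebra.Solver.CommutativeMonoid as CommutativeMonoidSolver
open import Data.Empty using (⊥)
open import Data.Fin.Base using (Fin; zero; suc; combine; remQuot; quotient; remainder; inject≤; _↑ˡ_; _↑ʳ_)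
open import Data.Fin.Patterns using (0F; 1F; 2F)
import Data.Fin.Properties as Fin
open import Data.List.Base using (List; []; _∷_; _++_; length; tabulate)
open import Data.List.Membership.Propositional using (_∈_)
open import Data.List.Properties using (length-++; length-tabulate)
open import Data.List.Relation.Binary.Sublist.Propositional using (_⊆_; []; _∷_; _∷ʳ_)
open import Data.List.Relation.Binary.Sublist.Propositional.Properties using (All-resp-⊆)
open import Data.List.Relation.Unary.All as All using (All; []; _∷_)
open import Data.List.Relation.Unary.All.Properties using (All¬⇒¬Any)
open import Data.List.Relation.Unary.AllPairs using (AllPairs; []; _∷_)
import Data.List.Relation.Unary.AllPairs.Properties as AllPairs
open import Data.List.Relation.Unary.Linked as Linked using (Linked; []; [-]; _∷_)
open import Data.Maybe.Base as Maybe using (Maybe; just; nothing; maybe)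
import Data.Maybe.Properties as Maybe
open import Data.Nat.Base as ℕ using (zero; suc; z≤n; s≤s; _^_; NonZero)
open import Data.Nat.Logarithm using (⌊log₂_⌋; ⌊log₂⌋-mono-≤; ⌊log₂[2^n]⌋≡n)
import Data.Nat.Properties as ℕ
open import Data.Nat.Tactic.RingSolver using (solve-∀)
open import Data.Product.Base using (_,_; proj₁; proj₂; uncurry)
open import Data.Product.Function.NonDependent.Propositional using (_×-↔_)
import Data.Product.Properties as Product
open import Data.Sum.Base using (_⊎_; inj₁; inj₂)
open import Data.Sum.Function.Propositional using (_⊎-↔_)
import Data.Sum.Properties as Sum
open import Data.Unit.Base using (tt)
open import Function.Base using (_∘_; _$_)
open import Function.Bundles using (_↔_; Injection; Inverse)
open import Function.Properties.Inverse using (↔-refl; ↔-trans; ↔-sym; ↔⇒↣)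
open import Level using (Lift; lift; _⊔_)
open import Relation.Binary.Definitions using (DecidableEquality)
open import Relation.Binary.PropositionalEquality as ≡ using (_≡_; _≢_; refl; cong; cong₂; subst)
import Relation.Binary.Reasoning.Setoid as SetoidReasoning
open import Relation.Nullary.Decidable using (yes; no; map′)
open import Relation.Nullary.Negation using (¬_; contradiction)

-- Dependency chains

-- Concatenation adds depth bounds, so running the `r` recursive products one after another would
-- only give a bound of order r^k. The recursion therefore acts on families: `multiply` treats all N
-- matrix pairs of a level at once, and a phase has one instruction per entry of the whole family.
-- An instruction also waits when it overwrites a result or an operand, so parallelism becomes a
-- question of memory layout. Every level gets cells of its own; within a phase, distinct targets
-- that no other instruction reads give independence. The number of cells is, up to a constant
-- factor, the same geometric sum as the work. The strict inequality r > q² matters here: for r = q²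
-- all k + 1 levels would have equal size, leaving a logarithmic factor. The coefficients of the
-- decomposition recur at every level, so 3 r q² hard-wired constants serve all matrix sizes.

private variable
  κ n t : ℕ

++-⊆-split : ∀ {a} {A : Set a} (ys : List A) {xs zs} → xs ⊆ ys ++ zs →
             ∃[ us ] ∃[ vs ] (xs ≡ us ++ vs × us ⊆ ys × vs ⊆ zs)
++-⊆-split []       p          = [] , _ , refl , [] , p
++-⊆-split (y ∷ ys) (.y ∷ʳ p)
  with us , vs , eq , p₁ , p₂ ← ++-⊆-split ys p = us , vs , eq , y ∷ʳ p₁ , p₂
++-⊆-split (y ∷ ys) (refl ∷ p)
  with us , vs , eq , p₁ , p₂ ← ++-⊆-split ys p = y ∷ us , vs , cong (y ∷_) eq , refl ∷ p₁ , p₂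

Linked-++⁻ : ∀ {a r} {A : Set a} {R : A → A → Set r} us {vs} →
             Linked R (us ++ vs) → Linked R us × Linked R vs
Linked-++⁻ []            l       = [] , l
Linked-++⁻ (u ∷ [])      l       = [-] , Linked.tail l
Linked-++⁻ (u ∷ u′ ∷ us) (r ∷ l) with l₁ , l₂ ← Linked-++⁻ (u′ ∷ us) l = r ∷ l₁ , l₂

-- A chain in the concatenation is a chain in `p` followed by one in `p′`; the link that joins them
-- is simply dropped.
Depth≤-++ : ∀ (p {p′} : Program κ n t) {d d′} → Depth≤ p d → Depth≤ p′ d′ → Depth≤ (p ++ p′) (d ℕ.+ d′)
Depth≤-++ p {d = d} {d′} dp dp′ chain⊆ linked
  with us , vs , refl , sub₁ , sub₂ ← ++-⊆-split p chain⊆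
  with linked₁ , linked₂ ← Linked-++⁻ us linked =
  subst (_≤ d ℕ.+ d′) (≡.sym (length-++ us)) (ℕ.+-mono-≤ (dp sub₁ linked₁) (dp′ sub₂ linked₂))

AllPairs-head₂ : ∀ {a r} {A : Set a} {R : A → A → Set r} {x y zs xs} →
                 AllPairs R xs → x ∷ y ∷ zs ⊆ xs → R x y
AllPairs-head₂ (_  ∷ rs) (_ ∷ʳ p)   = AllPairs-head₂ rs p
AllPairs-head₂ (rs ∷ _)  (refl ∷ p) = All.head (All-resp-⊆ p rs)

-- Comparing distinct indices lets an instruction read its own target. Both orders are covered, so
-- the enumeration of the index set is irrelevant.
Independent : ∀ {A : Set} → (A → Instruction κ n t) → Set
Independent I = ∀ {a b} → a ≢ b → ¬ (I a Precedes I b)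

-- Two conditions settle three kinds of dependency: reading an earlier target and overwriting an
-- earlier operand are the same condition with the indices exchanged.
independent : ∀ {A : Set} (I : A → Instruction κ n t) →
              (∀ {a b} → target (I a) ≡ target (I b) → a ≡ b) →
              (∀ {a b} → a ≢ b → All (target (I a) ≢_) (reads (operation (I b)))) →
              Independent I
independent I inj new a≢b (inj₁ x)        = All¬⇒¬Any (new a≢b) x
independent I inj new a≢b (inj₂ (inj₁ x)) = a≢b (inj x)
independent I inj new a≢b (inj₂ (inj₂ x)) = All¬⇒¬Any (new (a≢b ∘ ≡.sym)) x

phase : ∀ {A : Set} {N} → Fin N ↔ A → (A → Instruction κ n t) → Program κ n t
phase e I = tabulate (I ∘ Inverse.to e)

to-injective : ∀ {A B : Set} (e : A ↔ B) {x y} → Inverse.to e x ≡ Inverse.to e y → x ≡ y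
to-injective e = Injection.injective (↔⇒↣ e)

Depth≤-phase : ∀ {A : Set} {N} (e : Fin N ↔ A) (I : A → Instruction κ n t) →
               Independent I → Depth≤ (phase e I) 1
Depth≤-phase e I ind {[]}        _   _       = z≤n
Depth≤-phase e I ind {_ ∷ []}    _   _       = s≤s z≤n
Depth≤-phase e I ind {_ ∷ _ ∷ _} chain⊆ (r ∷ _) = contradiction r
  (AllPairs-head₂ (AllPairs.tabulate⁺ (λ i≢j → ind (i≢j ∘ to-injective e))) chain⊆)

cell-code : Cell n t → (Fin 3 × Fin n × Fin n) ⊎ Fin t
cell-code (matA i j) = inj₁ (0F , i , j)
cell-code (matB i j) = inj₁ (1F , i , j)
cell-code (matC i j) = inj₁ (2F , i , j)
cell-code (temp x)   = inj₂ x

cell-code-injective : {x y : Cell n t} → cell-code x ≡ cell-code y → x ≡ y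
cell-code-injective {x = matA _ _} {matA _ _} refl = refl
cell-code-injective {x = matB _ _} {matB _ _} refl = refl
cell-code-injective {x = matC _ _} {matC _ _} refl = refl
cell-code-injective {x = temp _}   {temp _}   refl = refl

_≟_ : DecidableEquality (Cell n t)
x ≟ y = map′ cell-code-injective (cong cell-code)
  (Sum.≡-dec (Product.≡-dec Fin._≟_ (Product.≡-dec Fin._≟_ Fin._≟_)) Fin._≟_ (cell-code x) (cell-code y))

-- Semantics: existence of runs through weakest preconditions

module Semantics {c ℓ₁ ℓ₂ : Level} (F : HeytingField c ℓ₁ ℓ₂) where

  open OverField F
  commutativeRing : CommutativeRing c ℓ₁
  commutativeRing = HeytingCommutativeRing.commutativeRing (HeytingField.heytingCommutativeRing F)
  open CommutativeRing commutativeRing public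
    hiding (zero)
    renaming (refl to ≈-refl; sym to ≈-sym; trans to ≈-trans; reflexive to ≈-reflexive)
  open SemiringSum semiring public

  update : Memory n t → Cell n t → Carrier → Memory n t
  update μ x v y with y ≟ x
  ... | yes _ = v
  ... | no  _ = μ y

  update-same : ∀ (μ : Memory n t) x {v} → update μ x v x ≡ v
  update-same μ x with x ≟ x
  ... | yes _  = refl
  ... | no x≢x = contradiction refl x≢x

  update-other : ∀ (μ : Memory n t) {x v y} → y ≢ x → update μ x v y ≡ μ y
  update-other μ {x} {y = y} y≢x with y ≟ x
  ... | yes y≡x = contradiction y≡x y≢x
  ... | no  _   = refl

  module _ (γ : Fin κ → Carrier) where

    Value-resp : ∀ {μ ν : Memory n t} {o : Operation κ n t} {v} →
                 All (λ x → ν x ≡ μ x) (reads o) → Value γ μ o v → Value γ ν o v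
    Value-resp []             (const p) = const p
    Value-resp (p ∷ q ∷ []) (add e) = add (≈-trans e (+-cong (≈-reflexive (≡.sym p)) (≈-reflexive (≡.sym q))))
    Value-resp (p ∷ q ∷ []) (sub e) = sub (≈-trans e (+-cong (≈-reflexive (≡.sym p)) (-‿cong (≈-reflexive (≡.sym q)))))
    Value-resp (p ∷ q ∷ []) (mul e) = mul (≈-trans e (*-cong (≈-reflexive (≡.sym p)) (≈-reflexive (≡.sym q))))
    Value-resp {v = v} (p ∷ q ∷ []) (div h e) =
      div (subst (λ z → HeytingField._#_ F z 0#) (≡.sym q) h)
          (≈-trans (≈-reflexive (cong (v *_) q)) (≈-trans e (≈-reflexive (≡.sym p))))

    -- A weakest precondition: from μ the program can be run into a memory satisfying Q.
    wp : ∀ {ℓ} → Program κ n t → (Memory n t → Set ℓ) → Memory n t → Set (c ⊔ ℓ₁ ⊔ ℓ₂ ⊔ ℓ)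
    wp {ℓ = ℓ} []      Q μ = Lift (c ⊔ ℓ₁ ⊔ ℓ₂) (Q μ)
    wp         (I ∷ p) Q μ = ∃[ v ] (Value γ μ (operation I) v × wp p Q (update μ (target I) v))

    wp-++ : ∀ {ℓ} (p {p′} : Program κ n t) {Q : Memory n t → Set ℓ} {μ} →
            wp p (wp p′ Q) μ → wp (p ++ p′) Q μ
    wp-++ []      (lift w) = w
    wp-++ (I ∷ p) (v , val , w)  = v , val , wp-++ p w

    wp⇒Run : ∀ {ℓ} (p : Program κ n t) {Q : Memory n t → Set ℓ} {μ} →
             wp p Q μ → ∃[ ν ] (Run γ p μ ν × Q ν)
    wp⇒Run []      {μ = μ} (lift w) = μ , [] (λ _ → ≈-refl) , w
    wp⇒Run (I ∷ p) {μ = μ} (v , val , w)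
      with ν , run , q ← wp⇒Run p w = ν , step ∷ run , q
      where
      step : Step γ I μ (update μ (target I) v)
      step = record
        { written   = subst (Value γ μ (operation I)) (≡.sym (update-same μ (target I))) val
        ; unchanged = λ x x≢ → ≈-reflexive (update-other μ x≢)
        }

    -- By independence no write changes an operand of another instruction, so every value `v i` may
    -- be computed in the initial memory `μ`: the list acts as a simultaneous assignment.
    wp-tabulate : ∀ {ℓ N} {I : Fin N → Instruction κ n t} {Q : Memory n t → Set ℓ} {μ} →
                  Independent I → (v : Fin N → Carrier) →
                  (∀ i → Value γ μ (operation (I i)) (v i)) →
                  (∀ ν → (∀ i → ν (target (I i)) ≡ v i) →
                         (∀ x → (∀ i → target (I i) ≢ x) → ν x ≡ μ x) → Q ν) →
                  wp (tabulate I) Q μ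
    wp-tabulate {N = zero}          ind v val post = lift (post _ (λ ()) (λ _ _ → refl))
    wp-tabulate {N = suc _} {I} {μ = μ} ind v val post =
      v 0F , val 0F , wp-tabulate (λ i≢j → ind (i≢j ∘ Fin.suc-injective)) (v ∘ suc)
        (λ i → Value-resp (All.tabulate λ {x} x∈ → update-other μ λ eq →
          ind {0F} {suc i} (λ ()) (inj₁ (subst (_∈ reads (operation (I (suc i)))) eq x∈))) (val (suc i)))
        (λ ν new old → post ν
          (λ { zero → ≡.trans (old _ (λ i eq → ind {0F} {suc i} (λ ()) (inj₂ (inj₁ (≡.sym eq)))))
                             (update-same μ (target (I 0F)))
             ; (suc i) → new i })
          (λ x untouched → ≡.trans (old x (untouched ∘ suc)) (update-other μ (untouched 0F ∘ ≡.sym))))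

    wp-phase : ∀ {ℓ N} {A : Set} (e : Fin N ↔ A) {I : A → Instruction κ n t} {Q : Memory n t → Set ℓ} {μ} →
               Independent I → (v : A → Carrier) →
               (∀ a → Value γ μ (operation (I a)) (v a)) →
               (∀ ν → (∀ a → ν (target (I a)) ≡ v a) →
                      (∀ x → (∀ a → target (I a) ≢ x) → ν x ≡ μ x) → Q ν) →
               wp (phase e I) Q μ
    wp-phase e {I} ind v val post =
      wp-tabulate (λ i≢j → ind (i≢j ∘ to-injective e)) (v ∘ to) (val ∘ to) λ ν new old → post ν
        (λ a → subst (λ b → ν (target (I b)) ≡ v b) (strictlyInverseˡ a) (new (from a)))
        (λ x untouched → old x (untouched ∘ to))
      where open Inverse e

-- Matrix algebra

lower : ∀ n {N} → Fin N → Maybe (Fin n)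
lower zero    _       = nothing
lower (suc n) zero    = just zero
lower (suc n) (suc i) = Maybe.map suc (lower n i)

lower-inject≤ : ∀ {n N} (i : Fin n) (n≤N : n ≤ N) → lower n (inject≤ i n≤N) ≡ just i
lower-inject≤ zero    (s≤s n≤N) = refl
lower-inject≤ (suc i) (s≤s n≤N) = cong (Maybe.map suc) (lower-inject≤ i n≤N)

module MatrixAlgebra {c ℓ₁ ℓ₂ : Level} (F : HeytingField c ℓ₁ ℓ₂) where

  open OverField F
  open Semantics F
  open SetoidReasoning setoid
  open CommutativeMonoidSolver *-commutativeMonoid using (solve; _⊕_; _⊜_)

  ∑-↑ : ∀ p {m} (f : Fin (p ℕ.+ m) → Carrier) → sum f ≈ sum (f ∘ (_↑ˡ m)) + sum (f ∘ (p ↑ʳ_))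
  ∑-↑ zero    f = ≈-sym (+-identityˡ _)
  ∑-↑ (suc p) f = ≈-trans (+-congˡ (∑-↑ p (f ∘ suc))) (≈-sym (+-assoc _ _ _))

  ∑-combine : ∀ q {p} (f : Fin (q ℕ.* p) → Carrier) → sum f ≈ ∑[ i < q ] ∑[ j < p ] f (combine i j)
  ∑-combine zero        f = ≈-refl
  ∑-combine (suc q) {p} f = ≈-trans (∑-↑ p f) (+-congˡ (∑-combine q (f ∘ (p ↑ʳ_))))

  ∑-remQuot : ∀ {q p} (f : Fin q × Fin p → Carrier) →
              sum (f ∘ remQuot p) ≈ ∑[ i < q ] ∑[ j < p ] f (i , j)
  ∑-remQuot {q} {p} f = ≈-trans (∑-combine q (f ∘ remQuot p))
    (sum-cong-≋ λ i → sum-cong-≋ λ j → ≈-reflexive (cong f (Fin.remQuot-combine i j)))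

  δ-suc : ∀ {q} (i j : Fin q) → δ (suc i) (suc j) ≡ δ i j
  δ-suc i j with i Fin.≟ j
  ... | yes _ = refl
  ... | no  _ = refl

  ∑-zero : ∀ {n} (f : Fin n → Carrier) → (∀ i → f i ≈ 0#) → sum f ≈ 0#
  ∑-zero {n} f f≈0 = ≈-trans (sum-cong-≋ f≈0) (sum-replicate-zero n)

  ∑-δ : ∀ {q} (i : Fin q) (f : Fin q → Carrier) → ∑[ j < q ] (δ j i * f j) ≈ f i
  ∑-δ {suc q} zero f = begin
    1# * f zero + sum (λ j → 0# * f (suc j))
      ≈⟨ +-cong (*-identityˡ _) (∑-zero {q} (λ j → 0# * f (suc j)) (λ _ → zeroˡ _)) ⟩
    f zero + 0#                              ≈⟨ +-identityʳ _ ⟩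
    f zero                                   ∎
  ∑-δ (suc i) f = begin
    0# * f zero + sum (λ j → δ (suc j) (suc i) * f (suc j))
      ≈⟨ +-cong (zeroˡ _) (sum-cong-≋ λ j → *-congʳ (≈-reflexive (δ-suc j i))) ⟩
    0# + sum (λ j → δ j i * f (suc j)) ≈⟨ +-identityˡ _ ⟩
    sum (λ j → δ j i * f (suc j))      ≈⟨ ∑-δ i (f ∘ suc) ⟩
    f (suc i)                          ∎

  ∑-*-∑ : ∀ {m n} (f : Fin m → Carrier) (g : Fin n → Carrier) →
          sum f * sum g ≈ ∑[ i < m ] ∑[ j < n ] (f i * g j)
  ∑-*-∑ f g = ≈-trans (*-distribʳ-sum (sum g) f) (sum-cong-≋ λ i → *-distribˡ-sum (f i) g)

  -- The three deltas leave one free index, the inner index of a matrix product. The third argument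
  -- is (k , i) because the third variable is z_ki.
  contract : ∀ {q} (f g : Fin q × Fin q → Carrier) i k →
    ∑[ y < q ℕ.* q ] ∑[ z < q ℕ.* q ]
      (⟨ q , q , q ⟩ (remQuot q y) (remQuot q z) (k , i) * (f (remQuot q y) * g (remQuot q z)))
    ≈ ∑[ j < q ] (f (i , j) * g (j , k))
  contract {q} f g i k = begin
    ∑[ y < q ℕ.* q ] ∑[ z < q ℕ.* q ]
      (T (remQuot q y) (remQuot q z) (k , i) * (f (remQuot q y) * g (remQuot q z)))
      ≈⟨ ∑-remQuot (λ x → ∑[ z < q ℕ.* q ] (T x (remQuot q z) (k , i) * (f x * g (remQuot q z)))) ⟩
    ∑[ a < q ] ∑[ b < q ] ∑[ z < q ℕ.* q ]
      (T (a , b) (remQuot q z) (k , i) * (f (a , b) * g (remQuot q z)))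
      ≈⟨ sum-cong-≋ (λ a → sum-cong-≋ λ b → ∑-remQuot (λ x → T (a , b) x (k , i) * (f (a , b) * g x))) ⟩
    ∑[ a < q ] ∑[ b < q ] ∑[ c < q ] ∑[ d < q ]
      (δ a i * δ b c * δ d k * (f (a , b) * g (c , d)))
      ≈⟨ sum-cong-≋ (λ a → sum-cong-≋ λ b → sum-cong-≋ λ c → ≈-trans
           (sum-cong-≋ λ d → solve 5 (λ u v w x y → ((u ⊕ v) ⊕ w) ⊕ (x ⊕ y) ⊜ w ⊕ (v ⊕ (u ⊕ (x ⊕ y)))) ≈-refl
             (δ a i) (δ b c) (δ d k) (f (a , b)) (g (c , d)))
           (∑-δ k λ d → δ b c * (δ a i * (f (a , b) * g (c , d))))) ⟩
    ∑[ a < q ] ∑[ b < q ] ∑[ c < q ] (δ b c * (δ a i * (f (a , b) * g (c , k))))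
      -- `∑-δ` sums over the first argument of `δ`, so in δ b c it is `b` that disappears, after an
      -- exchange of the sums.
      ≈⟨ sum-cong-≋ (λ a → ≈-trans (∑-comm λ b c → δ b c * (δ a i * (f (a , b) * g (c , k))))
           (sum-cong-≋ λ c → ∑-δ c λ b → δ a i * (f (a , b) * g (c , k)))) ⟩
    ∑[ a < q ] ∑[ c < q ] (δ a i * (f (a , c) * g (c , k)))
      ≈⟨ ∑-comm (λ a c → δ a i * (f (a , c) * g (c , k))) ⟩
    ∑[ c < q ] ∑[ a < q ] (δ a i * (f (a , c) * g (c , k)))
      ≈⟨ sum-cong-≋ (λ c → ∑-δ i λ a → f (a , c) * g (c , k)) ⟩
    ∑[ c < q ] (f (i , c) * g (c , k)) ∎
    where T = ⟨ q , q , q ⟩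

  ·-cong : ∀ {n} {A A′ B B′ : Matrix n} → (∀ i j → A i j ≈ A′ i j) → (∀ i j → B i j ≈ B′ i j) →
           ∀ i k → (A · B) i k ≈ (A′ · B′) i k
  ·-cong A≈ B≈ i k = sum-cong-≋ λ j → *-cong (A≈ i j) (B≈ j k)

  combineBlocks : ∀ {q p} → (Fin (q ℕ.* q) → Carrier) → Matrix (q ℕ.* p) → Matrix p
  combineBlocks {q} {p} u A i j =
    ∑[ y < q ℕ.* q ] (u y * A (combine (quotient {q} q y) i) (combine (remainder {q} q y) j))

  -- Blocks do not commute, while the decomposition is an identity over the field. It is therefore
  -- applied entrywise: for a fixed inner position `j` within the blocks, the relevant entries form
  -- the scalar q × q matrices `a j` and `b j`.
  block-product-combine : ∀ {q r p} (u v w : Fin r → Fin q × Fin q → Carrier) →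
    (∀ x y z → ⟨ q , q , q ⟩ x y z ≈ ∑[ l < r ] (u l x * v l y * w l z)) →
    ∀ (A B : Matrix (q ℕ.* p)) i i′ k k′ →
    ∑[ l < r ] (w l (k , i) *
      (combineBlocks {q} (u l ∘ remQuot q) A · combineBlocks {q} (v l ∘ remQuot q) B) i′ k′)
    ≈ (A · B) (combine i i′) (combine k k′)
  block-product-combine {q} {r} {p} u v w T≈ A B i i′ k k′ = begin
    ∑[ l < r ] (w l (k , i) * ∑[ j < p ] cross l j)
      ≈⟨ sum-cong-≋ (λ l → ≈-trans (*-distribˡ-sum (w l (k , i)) (cross l)) (sum-cong-≋ λ j → expand l j)) ⟩
    ∑[ l < r ] ∑[ j < p ] ∑[ y < q ℕ.* q ] ∑[ z < q ℕ.* q ] term l j y z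
      ≈⟨ ∑-comm (λ l j → ∑[ y < q ℕ.* q ] ∑[ z < q ℕ.* q ] term l j y z) ⟩
    ∑[ j < p ] ∑[ l < r ] ∑[ y < q ℕ.* q ] ∑[ z < q ℕ.* q ] term l j y z
      ≈⟨ sum-cong-≋ (λ j → ≈-trans (∑-comm λ l y → ∑[ z < q ℕ.* q ] term l j y z)
           (sum-cong-≋ λ y → ≈-trans (∑-comm λ l z → term l j y z) (sum-cong-≋ λ z → collect j y z))) ⟩
    ∑[ j < p ] ∑[ y < q ℕ.* q ] ∑[ z < q ℕ.* q ]
      (⟨ q , q , q ⟩ (rq y) (rq z) (k , i) * (a j (rq y) * b j (rq z)))
      ≈⟨ sum-cong-≋ (λ j → contract (a j) (b j) i k) ⟩
    ∑[ j < p ] ∑[ j₀ < q ] (a j (i , j₀) * b j (j₀ , k))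
      ≈⟨ ∑-comm (λ j j₀ → a j (i , j₀) * b j (j₀ , k)) ⟩
    ∑[ j₀ < q ] ∑[ j < p ] (a j (i , j₀) * b j (j₀ , k))
      -- Block number and position within the block together run through the whole inner index.
      ≈⟨ ∑-combine q (λ J → A (combine i i′) J * B J (combine k k′)) ⟨
    (A · B) (combine i i′) (combine k k′) ∎
    where
    rq = remQuot {q} q
    a b : Fin p → Fin q × Fin q → Carrier
    a j (y₁ , y₂) = A (combine y₁ i′) (combine y₂ j)
    b j (z₁ , z₂) = B (combine z₁ j) (combine z₂ k′)
    cross : Fin r → Fin p → Carrier
    cross l j = ∑[ y < q ℕ.* q ] (u l (rq y) * a j (rq y)) * ∑[ z < q ℕ.* q ] (v l (rq z) * b j (rq z))
    term : Fin r → Fin p → Fin (q ℕ.* q) → Fin (q ℕ.* q) → Carrier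
    term l j y z = u l (rq y) * v l (rq z) * w l (k , i) * (a j (rq y) * b j (rq z))
    expand : ∀ l j → w l (k , i) * cross l j ≈ ∑[ y < q ℕ.* q ] ∑[ z < q ℕ.* q ] term l j y z
    expand l j = begin
      w l (k , i) * cross l j
        ≈⟨ *-congˡ (∑-*-∑ (λ y → u l (rq y) * a j (rq y)) (λ z → v l (rq z) * b j (rq z))) ⟩
      w l (k , i) * ∑[ y < q ℕ.* q ] ∑[ z < q ℕ.* q ] (u l (rq y) * a j (rq y) * (v l (rq z) * b j (rq z)))
        ≈⟨ ≈-trans (*-distribˡ-sum (w l (k , i)) (λ y → ∑[ z < q ℕ.* q ] factors y z))
             (sum-cong-≋ λ y → *-distribˡ-sum (w l (k , i)) (factors y)) ⟩
      ∑[ y < q ℕ.* q ] ∑[ z < q ℕ.* q ] (w l (k , i) * (u l (rq y) * a j (rq y) * (v l (rq z) * b j (rq z))))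
        ≈⟨ sum-cong-≋ (λ y → sum-cong-≋ λ z →
             solve 5 (λ s t x y z → s ⊕ ((t ⊕ x) ⊕ (y ⊕ z)) ⊜ ((t ⊕ y) ⊕ s) ⊕ (x ⊕ z)) ≈-refl
               (w l (k , i)) (u l (rq y)) (a j (rq y)) (v l (rq z)) (b j (rq z))) ⟩
      ∑[ y < q ℕ.* q ] ∑[ z < q ℕ.* q ] term l j y z ∎
      where
      factors : Fin (q ℕ.* q) → Fin (q ℕ.* q) → Carrier
      factors y z = u l (rq y) * a j (rq y) * (v l (rq z) * b j (rq z))
    collect : ∀ j y z → ∑[ l < r ] term l j y z
            ≈ ⟨ q , q , q ⟩ (rq y) (rq z) (k , i) * (a j (rq y) * b j (rq z))
    collect j y z = ≈-trans
      (≈-sym (*-distribʳ-sum (a j (rq y) * b j (rq z)) (λ l → u l (rq y) * v l (rq z) * w l (k , i))))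
      (*-congʳ (≈-sym (T≈ (rq y) (rq z) (k , i))))

  -- A zero term lengthens the decomposition. This allows the number of products to exceed q², as
  -- the cost estimates require.
  Rank≤-suc : ∀ {X Y Z : Set} {T : Tensor X Y Z} {r} → Rank≤ T r → Rank≤ T (suc r)
  Rank≤-suc {X} {Y} {Z} {r = r} (u , v , w , T≈) = extend u , extend v , extend w , λ x y z →
    ≈-trans (T≈ x y z) (≈-sym (≈-trans (+-congʳ (≈-trans (*-congʳ (zeroˡ _)) (zeroˡ _))) (+-identityˡ _)))
    where
    extend : ∀ {X : Set} → (Fin r → X → Carrier) → Fin (suc r) → X → Carrier
    extend u zero    _ = 0#
    extend u (suc l) x = u l x

  Rank≤-mono : ∀ {X Y Z : Set} {T : Tensor X Y Z} {r s} → r ℕ.≤′ s → Rank≤ T r → Rank≤ T s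
  Rank≤-mono (ℕ.≤′-reflexive refl) R = R
  Rank≤-mono {T = T} (ℕ.≤′-step p) R = Rank≤-suc {T = T} (Rank≤-mono {T = T} p R)

  ∑-lower : ∀ {n N} → n ≤ N → (f : Fin n → Carrier) → ∑[ i < N ] maybe f 0# (lower n i) ≈ sum f
  ∑-lower {N = N} z≤n f = ∑-zero {N} (λ _ → 0#) (λ _ → ≈-refl)
  ∑-lower {suc n} {suc N} (s≤s n≤N) f = +-congˡ (≈-trans
    (sum-cong-≋ {N} λ i → ≈-reflexive (Maybe.maybe′-map f 0# suc (lower n i))) (∑-lower n≤N (f ∘ suc)))

  pad : ∀ {n N} → Matrix n → Matrix N
  pad {n} A i j = maybe (uncurry A) 0# (Maybe.zip (lower n i) (lower n j))

  -- Inner indices added by the padding contribute zero terms, so the original product survives in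
  -- the corner of the padded one.
  pad-· : ∀ {n N} (n≤N : n ≤ N) (A B : Matrix n) i k →
          (pad A · pad B) (inject≤ i n≤N) (inject≤ k n≤N) ≈ (A · B) i k
  pad-· {n} n≤N A B i k = ≈-trans (sum-cong-≋ entry) (∑-lower n≤N λ j → A i j * B j k)
    where
    entry : ∀ J → pad A (inject≤ i n≤N) J * pad B J (inject≤ k n≤N) ≈
                  maybe (λ j → A i j * B j k) 0# (lower n J)
    entry J rewrite lower-inject≤ i n≤N | lower-inject≤ k n≤N with lower n J
    ... | just _  = ≈-refl
    ... | nothing = zeroˡ _

-- Building blocks of programs

module Copying {κ n t N : ℕ} {A : Set} (e : Fin N ↔ A) (acc : A → Cell n t)
  (acc-injective : ∀ {a b} → acc a ≡ acc b → a ≡ b) where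

  -- Cells start with arbitrary contents; x - x makes a zero without a hard-wired constant.
  clear : A → Instruction κ n t
  clear a = acc a ≔ sub (acc a) (acc a)

  clear-independent : Independent clear
  clear-independent = independent clear acc-injective
    λ a≢b → (a≢b ∘ acc-injective) ∷ (a≢b ∘ acc-injective) ∷ []

  module _ (src : A → Maybe (Cell n t)) where

    -- There is no move instruction: a copy adds the source to a cleared cell. Without a source the
    -- cell is cleared again, so the phase has the same length for every `src`.
    fetch : A → Operation κ n t
    fetch a = maybe (add (acc a)) (sub (acc a) (acc a)) (src a)

    fill : A → Instruction κ n t
    fill a = acc a ≔ fetch a

    copy : Program κ n t
    copy = phase e clear ++ phase e fill

    length-copy : length copy ≡ N ℕ.+ N
    length-copy = ≡.trans (length-++ (phase e clear))
      (cong₂ ℕ._+_ (length-tabulate (clear ∘ Inverse.to e)) (length-tabulate (fill ∘ Inverse.to e)))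

    module _ (src-fresh : ∀ a b {x} → src a ≡ just x → acc b ≢ x) where

      fill-independent : Independent fill
      fill-independent = independent fill acc-injective λ {a} {b} a≢b → reads-fresh a≢b (src b) refl
        where
        reads-fresh : ∀ {a b} → a ≢ b → ∀ s → src b ≡ s →
          All (acc a ≢_) (reads {κ} (maybe (add (acc b)) (sub (acc b) (acc b)) s))
        reads-fresh a≢b nothing  _  = (a≢b ∘ acc-injective) ∷ (a≢b ∘ acc-injective) ∷ []
        reads-fresh {a} {b} a≢b (just x) eq = (a≢b ∘ acc-injective) ∷ src-fresh b a eq ∷ []

      Depth≤-copy : Depth≤ copy 2
      Depth≤-copy = Depth≤-++ (phase e clear)
        (Depth≤-phase e clear clear-independent) (Depth≤-phase e fill fill-independent)

      module _ {c ℓ₁ ℓ₂ : Level} (F : HeytingField c ℓ₁ ℓ₂) where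
        open OverField F
        open Semantics F

        wp-copy : ∀ {ℓ} (γ : Fin κ → Carrier) {Q : Memory n t → Set ℓ} {μ} →
                  (∀ ν → (∀ a → ν (acc a) ≈ maybe μ 0# (src a)) →
                         (∀ x → (∀ a → acc a ≢ x) → ν x ≡ μ x) → Q ν) →
                  wp γ copy Q μ
        wp-copy γ {Q} {μ} post = wp-++ γ (phase e clear)
          (wp-phase γ e clear-independent (λ _ → 0#) (λ a → sub (≈-sym (-‿inverseʳ (μ (acc a)))))
            λ ν cleared old → wp-phase γ e fill-independent (λ a → maybe μ 0# (src a))
              (λ a → value ν cleared old a (src a) refl)
              λ ξ filled old′ → post ξ (λ a → ≈-reflexive (filled a))
                (λ x untouched → ≡.trans (old′ x untouched) (old x untouched)))
          where
          value : ∀ ν → (∀ a → ν (acc a) ≡ 0#) → (∀ x → (∀ a → acc a ≢ x) → ν x ≡ μ x) →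
                  ∀ a s → src a ≡ s →
                  Value γ ν (maybe (add (acc a)) (sub (acc a) (acc a)) s) (maybe μ 0# s)
          value ν cleared old a nothing  _  = sub (≈-sym (-‿inverseʳ (ν (acc a))))
          value ν cleared old a (just x) eq = add (≈-sym (≈-trans
            (+-cong (≈-reflexive (cleared a)) (≈-reflexive (old x λ b → src-fresh a b eq))) (+-identityˡ _)))

module LinearCombination {κ n t N : ℕ} {A : Set} (e : Fin N ↔ A) (acc scr : A → Cell n t)
  (acc-injective : ∀ {a b} → acc a ≡ acc b → a ≡ b)
  (scr-injective : ∀ {a b} → scr a ≡ scr b → a ≡ b)
  (acc≢scr : ∀ {a b} → acc a ≢ scr b) where

  open Copying {κ} e acc acc-injective using (clear; clear-independent)

  -- The quantifier ranges over all indices because a source must survive the writes of every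
  -- parallel instance and of all earlier terms.
  Fresh : Cell n t → Set
  Fresh x = ∀ a → acc a ≢ x × scr a ≢ x

  load : (A → Fin κ) → A → Instruction κ n t
  load co a = scr a ≔ const (co a)

  scale : (A → Cell n t) → A → Instruction κ n t
  scale src a = scr a ≔ mul (scr a) (src a)

  accumulate : A → Instruction κ n t
  accumulate a = acc a ≔ add (scr a) (acc a)

  addTerm : (A → Fin κ) → (A → Cell n t) → Program κ n t
  addTerm co src = phase e (load co) ++ phase e (scale src) ++ phase e accumulate

  -- Terms are added one after another: `s` will be q * q or r, independent of the matrix size, so
  -- the depth stays bounded while all indices in `A` proceed in parallel. Term 0 comes last because
  -- `sum` has it at the head.
  linear : ∀ {s} → (A → Fin s → Fin κ) → (A → Fin s → Cell n t) → Program κ n t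
  linear {zero}  co src = phase e clear
  linear {suc s} co src =
    linear (λ a → co a ∘ suc) (λ a → src a ∘ suc) ++ addTerm (λ a → co a 0F) (λ a → src a 0F)

  length-addTerm : ∀ co src → length (addTerm co src) ≡ 3 ℕ.* N
  length-addTerm co src = ≡.trans (length-++ (phase e (load co)))
    (cong₂ ℕ._+_ (length-tabulate (load co ∘ to))
      (≡.trans (length-++ (phase e (scale src)))
        (cong₂ ℕ._+_ (length-tabulate (scale src ∘ to))
                     (≡.trans (length-tabulate (accumulate ∘ to)) (≡.sym (ℕ.+-identityʳ N))))))
    where open Inverse e

  length-linear : ∀ {s} co src → length (linear {s} co src) ≡ (1 ℕ.+ 3 ℕ.* s) ℕ.* N
  length-linear {zero}  co src = ≡.trans (length-tabulate (clear ∘ Inverse.to e)) (≡.sym (ℕ.+-identityʳ N))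
  length-linear {suc s} co src = begin
    length (linear co′ src′ ++ addTerm co₀ src₀)          ≡⟨ length-++ (linear co′ src′) ⟩
    length (linear co′ src′) ℕ.+ length (addTerm co₀ src₀)
      ≡⟨ cong₂ ℕ._+_ (length-linear co′ src′) (length-addTerm co₀ src₀) ⟩
    (1 ℕ.+ 3 ℕ.* s) ℕ.* N ℕ.+ 3 ℕ.* N                     ≡⟨ ℕ.*-distribʳ-+ N (1 ℕ.+ 3 ℕ.* s) 3 ⟨
    (1 ℕ.+ 3 ℕ.* s ℕ.+ 3) ℕ.* N                           ≡⟨ cong (λ m → suc m ℕ.* N) (ℕ.+-comm (3 ℕ.* s) 3) ⟩
    (1 ℕ.+ (3 ℕ.+ 3 ℕ.* s)) ℕ.* N                         ≡⟨ cong (λ m → suc m ℕ.* N) (ℕ.*-suc 3 s) ⟨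
    (1 ℕ.+ 3 ℕ.* suc s) ℕ.* N                             ∎
    where
    open ≡.≡-Reasoning
    co′ = λ a → co a ∘ suc
    src′ = λ a → src a ∘ suc
    co₀ = λ a → co a 0F
    src₀ = λ a → src a 0F

  load-independent : ∀ co → Independent (load co)
  load-independent co = independent (load co) scr-injective λ _ → []

  scale-independent : ∀ {src} → (∀ a → Fresh (src a)) → Independent (scale src)
  scale-independent {src} fresh = independent (scale src) scr-injective
    λ {a} {b} a≢b → (a≢b ∘ scr-injective) ∷ proj₂ (fresh b a) ∷ []

  accumulate-independent : Independent accumulate
  accumulate-independent = independent accumulate acc-injective
    λ a≢b → acc≢scr ∷ (a≢b ∘ acc-injective) ∷ []

  Depth≤-addTerm : ∀ co {src} → (∀ a → Fresh (src a)) → Depth≤ (addTerm co src) 3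
  Depth≤-addTerm co {src} fresh = Depth≤-++ (phase e (load co))
    (Depth≤-phase e (load co) (load-independent co))
    (Depth≤-++ (phase e (scale src)) (Depth≤-phase e (scale src) (scale-independent fresh))
      (Depth≤-phase e accumulate accumulate-independent))

  Depth≤-linear : ∀ {s} co {src : A → Fin s → Cell n t} → (∀ a x → Fresh (src a x)) →
                  Depth≤ (linear co src) (1 ℕ.+ 3 ℕ.* s)
  Depth≤-linear {zero}  co fresh = Depth≤-phase e clear clear-independent
  Depth≤-linear {suc s} co {src} fresh = subst (Depth≤ (linear co src)) eq
    (Depth≤-++ (linear (λ a → co a ∘ suc) (λ a → src a ∘ suc))
      (Depth≤-linear (λ a → co a ∘ suc) (λ a → fresh a ∘ suc))
      (Depth≤-addTerm (λ a → co a 0F) (λ a → fresh a 0F)))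
    where
    eq : 1 ℕ.+ 3 ℕ.* s ℕ.+ 3 ≡ 1 ℕ.+ 3 ℕ.* suc s
    eq = cong suc (≡.trans (ℕ.+-comm (3 ℕ.* s) 3) (≡.sym (ℕ.*-suc 3 s)))

  module _ {c ℓ₁ ℓ₂ : Level} (F : HeytingField c ℓ₁ ℓ₂) where
    open OverField F
    open Semantics F

    wp-addTerm : ∀ {ℓ} (γ : Fin κ → Carrier) co {src} → (∀ a → Fresh (src a)) →
                 ∀ {Q : Memory n t → Set ℓ} {μ} →
                 (∀ ν → (∀ a → ν (acc a) ≈ γ (co a) * μ (src a) + μ (acc a)) →
                        (∀ x → Fresh x → ν x ≡ μ x) → Q ν) →
                 wp γ (addTerm co src) Q μ
    wp-addTerm γ co {src} fresh {Q} {μ} post = wp-++ γ (phase e (load co))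
      (wp-phase γ e (load-independent co) (γ ∘ co) (λ _ → const ≈-refl)
      λ μ₁ loaded old₁ → wp-++ γ (phase e (scale src))
      (wp-phase γ e (scale-independent fresh) (λ a → γ (co a) * μ (src a))
        (λ a → mul (≈-sym (*-cong (≈-reflexive (loaded a)) (≈-reflexive (old₁ (src a) (proj₂ ∘ fresh a))))))
      λ μ₂ scaled old₂ → wp-phase γ e accumulate-independent (λ a → γ (co a) * μ (src a) + μ (acc a))
        (λ a → add (≈-sym (+-cong (≈-reflexive (scaled a)) (≈-reflexive
          (≡.trans (old₂ (acc a) (λ _ → acc≢scr ∘ ≡.sym)) (old₁ (acc a) (λ _ → acc≢scr ∘ ≡.sym)))))))
      λ ν accumulated old₃ → post ν (≈-reflexive ∘ accumulated)
        (λ x f → ≡.trans (old₃ x (proj₁ ∘ f)) (≡.trans (old₂ x (proj₂ ∘ f)) (old₁ x (proj₂ ∘ f))))))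

    wp-linear : ∀ {ℓ s} (γ : Fin κ → Carrier) co {src : A → Fin s → Cell n t} → (∀ a x → Fresh (src a x)) →
                ∀ {Q : Memory n t → Set ℓ} {μ} →
                (∀ ν → (∀ a → ν (acc a) ≈ ∑[ x < s ] (γ (co a x) * μ (src a x))) →
                       (∀ x → Fresh x → ν x ≡ μ x) → Q ν) →
                wp γ (linear co src) Q μ
    wp-linear {s = zero} γ co fresh {μ = μ} post =
      wp-phase γ e clear-independent (λ _ → 0#) (λ a → sub (≈-sym (-‿inverseʳ (μ (acc a)))))
      λ ν cleared old → post ν (≈-reflexive ∘ cleared) (λ x f → old x (proj₁ ∘ f))
    wp-linear {s = suc s} γ co {src} fresh {μ = μ} post =
      wp-++ γ (linear (λ a → co a ∘ suc) (λ a → src a ∘ suc))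
      (wp-linear γ (λ a → co a ∘ suc) (λ a → fresh a ∘ suc)
      λ μ₁ partial old₁ → wp-addTerm γ (λ a → co a 0F) (λ a → fresh a 0F)
      λ ν new old₂ → post ν
        (λ a → ≈-trans (new a) (+-cong (*-congˡ (≈-reflexive (old₁ (src a 0F) (fresh a 0F)))) (partial a)))
        (λ x f → ≡.trans (old₂ x f) (old₁ x f)))

-- The bilinear recursion

Array : Set
Array = Fin 4

pattern left    = zero
pattern right   = suc zero
pattern product = suc (suc zero)
pattern scratch = suc (suc (suc zero))

module Recursion (q r : ℕ) where

  -- After j of j + m levels there is one q^m × q^m matrix for each of the r^j
  -- elements of J = [r]^j.
  Entry : Set → ℕ → Set
  Entry J m = J × Fin (q ^ m) × Fin (q ^ m)

  -- Levels are separated by a disjoint sum instead of address offsets: that their cells differ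
  -- reduces to `inj₁` against `inj₂`.
  Slot Deeper : Set → ℕ → Set
  Slot J m         = Entry J m ⊎ Deeper J m
  Deeper J zero    = ⊥
  Deeper J (suc m) = Slot (Fin r × J) m

  entries : ℕ → ℕ → ℕ
  entries N m = N ℕ.* (q ^ m ℕ.* q ^ m)

  slots deeper : ℕ → ℕ → ℕ
  slots N m        = entries N m ℕ.+ deeper N m
  deeper N zero    = 0
  deeper N (suc m) = slots (r ℕ.* N) m

  module _ {J : Set} {N : ℕ} (e : Fin N ↔ J) where

    extend↔ : Fin (r ℕ.* N) ↔ (Fin r × J)
    extend↔ = ↔-trans Fin.*↔× (↔-refl ×-↔ e)

    entry↔ : ∀ m → Fin (entries N m) ↔ Entry J m
    entry↔ m = ↔-trans Fin.*↔× (e ×-↔ Fin.*↔×)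

  slot↔   : ∀ {J N} → Fin N ↔ J → ∀ m → Fin (slots N m) ↔ Slot J m
  deeper↔ : ∀ {J N} → Fin N ↔ J → ∀ m → Fin (deeper N m) ↔ Deeper J m
  slot↔   e m       = ↔-trans Fin.+↔⊎ (entry↔ e m ⊎-↔ deeper↔ e m)
  deeper↔ e zero    = Fin.0↔⊥
  deeper↔ e (suc m) = slot↔ (extend↔ e) m

  constantCount : ℕ
  constantCount = 3 ℕ.* (r ℕ.* (q ℕ.* q))

  coefficient : Fin 3 → Fin r → Fin (q ℕ.* q) → Fin constantCount
  coefficient f l y = combine f (combine l y)

  -- Addresses are abstracted to a map into memory, later assumed injective; a recursive call gets
  -- its storage by restricting the map to the deeper slots.
  Placement : Set → ℕ → ℕ → ℕ → Set
  Placement J m n t = Array × Slot J m → Cell n t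

  Separating : ∀ {J m n t} → Placement J m n t → Set
  Separating ι = ∀ {s s′} → ι s ≡ ι s′ → s ≡ s′

  module Entries {J : Set} {m n t : ℕ} (ι : Placement J m n t) (ι-injective : Separating {J} {m} ι) where

    entry : Array → Entry J m → Cell n t
    entry α a = ι (α , inj₁ a)

    entry-injective : ∀ α {a b} → entry α a ≡ entry α b → a ≡ b
    entry-injective α eq = Sum.inj₁-injective (cong proj₂ (ι-injective eq))

    array-distinct : ∀ {α β} → α ≢ β → ∀ {a b} → entry α a ≢ entry β b
    array-distinct α≢β eq = α≢β (cong proj₁ (ι-injective eq))

  descend : ∀ {J m n t} → Placement J (suc m) n t → Placement (Fin r × J) m n t
  descend ι (α , s) = ι (α , inj₂ s)

  descend-injective : ∀ {J m n t} (ι : Placement J (suc m) n t) →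
                      Separating {J} {suc m} ι → Separating {Fin r × J} {m} (descend {J} {m} ι)
  descend-injective ι ι-injective eq with refl ← ι-injective eq = refl

  module Branch {J : Set} {N : ℕ} (e : Fin N ↔ J) (m : ℕ) {n t : ℕ} (ι : Placement J (suc m) n t)
               (ι-injective : Separating {J} {suc m} ι) where

    open Entries {J} {suc m} ι ι-injective public
    module Below = Entries {Fin r × J} {m} (descend {J} {m} ι) (descend-injective ι ι-injective)

    -- Serves freshness in both directions: the downward passes read this level and write below, the
    -- upward pass does the converse.
    below≢ : ∀ {α β a b} → Below.entry α a ≢ entry β b
    below≢ eq with () ← cong proj₂ (ι-injective eq)

    module Down (α : Array) (α≢scratch : α ≢ scratch) = LinearCombination {constantCount}
      (entry↔ (extend↔ e) m) (Below.entry α) (Below.entry scratch)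
      (Below.entry-injective α) (Below.entry-injective scratch) (Below.array-distinct α≢scratch)

    module Up = LinearCombination {constantCount}
      (entry↔ e (suc m)) (entry product) (entry scratch)
      (entry-injective product) (entry-injective scratch) (array-distinct λ ())

    downSource : Array → Entry (Fin r × J) m → Fin (q ℕ.* q) → Cell n t
    downSource α ((l , x) , i , j) y = entry α (x , combine (quotient {q} q y) i , combine (remainder {q} q y) j)

    downCoefficient : Fin 3 → Entry (Fin r × J) m → Fin (q ℕ.* q) → Fin constantCount
    downCoefficient f ((l , _) , _) = coefficient f l

    downSource-fresh : ∀ α α≢scratch β a y → Down.Fresh α α≢scratch (downSource β a y)
    downSource-fresh α α≢scratch β a y b = below≢ , below≢

    upSource : Entry J (suc m) → Fin r → Cell n t
    upSource (x , i , k) l = Below.entry product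
      ((l , x) , remainder {q} (q ^ m) i , remainder {q} (q ^ m) k)

    -- The third factor of ⟨q,q,q⟩ is z_ki, so w is indexed by (column , row).
    upCoefficient : Entry J (suc m) → Fin r → Fin constantCount
    upCoefficient (x , i , k) l = coefficient 2F l (combine (quotient {q} (q ^ m) k) (quotient {q} (q ^ m) i))

    upSource-fresh : ∀ a l → Up.Fresh (upSource a l)
    upSource-fresh a l b = (below≢ ∘ ≡.sym) , (below≢ ∘ ≡.sym)

    downLeft downRight up : Program constantCount n t
    downLeft  = Down.linear left  (λ ()) (downCoefficient 0F) (downSource left)
    downRight = Down.linear right (λ ()) (downCoefficient 1F) (downSource right)
    up        = Up.linear upCoefficient upSource

  module Leaf {J : Set} {N : ℕ} (e : Fin N ↔ J) {n t : ℕ} (ι : Placement J 0 n t)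
              (ι-injective : Separating {J} {0} ι) where

    open Entries {J} {0} ι ι-injective

    -- At level 0 the matrices have size q ^ 0 = 1, so `0F` is the only inner index and one
    -- multiplication is the whole product.
    leaf : Entry J 0 → Instruction constantCount n t
    leaf (x , i , k) = entry product (x , i , k) ≔ mul (entry left (x , i , 0F)) (entry right (x , 0F , k))

    leaf-independent : Independent leaf
    leaf-independent = independent leaf (entry-injective product)
      λ _ → array-distinct (λ ()) ∷ array-distinct (λ ()) ∷ []

  multiply : ∀ {J N} (e : Fin N ↔ J) m {n t} (ι : Placement J m n t) → Separating {J} {m} ι → Program constantCount n t
  multiply e zero    ι ι-injective = phase (entry↔ e 0) (Leaf.leaf e ι ι-injective)
  multiply {J} e (suc m) ι ι-injective =
    downLeft ++ downRight ++ multiply (extend↔ e) m (descend {J} {m} ι) (descend-injective ι ι-injective) ++ up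
    where open Branch e m ι ι-injective

  -- The size N of the family does not occur: it affects the work only.
  multiplyDepth : ℕ → ℕ
  multiplyDepth zero    = 1
  multiplyDepth (suc m) =
    1 ℕ.+ 3 ℕ.* (q ℕ.* q) ℕ.+ (1 ℕ.+ 3 ℕ.* (q ℕ.* q) ℕ.+ (multiplyDepth m ℕ.+ (1 ℕ.+ 3 ℕ.* r)))

  Depth≤-multiply : ∀ {J N} (e : Fin N ↔ J) m {n t} (ι : Placement J m n t) (ι-injective : Separating {J} {m} ι) →
                    Depth≤ (multiply e m ι ι-injective) (multiplyDepth m)
  Depth≤-multiply e zero ι ι-injective =
    Depth≤-phase (entry↔ e 0) (Leaf.leaf e ι ι-injective) (Leaf.leaf-independent e ι ι-injective)
  Depth≤-multiply {J} e (suc m) ι ι-injective =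
    Depth≤-++ downLeft (Down.Depth≤-linear left (λ ()) (downCoefficient 0F) (downSource-fresh left (λ ()) left))
    (Depth≤-++ downRight (Down.Depth≤-linear right (λ ()) (downCoefficient 1F) (downSource-fresh right (λ ()) right))
    (Depth≤-++ (multiply (extend↔ e) m (descend {J} {m} ι) (descend-injective ι ι-injective))
      (Depth≤-multiply (extend↔ e) m (descend {J} {m} ι) (descend-injective ι ι-injective))
      (Up.Depth≤-linear upCoefficient upSource-fresh)))
    where open Branch e m ι ι-injective

  multiplyWork : ℕ → ℕ → ℕ
  multiplyWork N zero    = entries N 0
  multiplyWork N (suc m) =
    (1 ℕ.+ 3 ℕ.* (q ℕ.* q)) ℕ.* entries (r ℕ.* N) m ℕ.+
    ((1 ℕ.+ 3 ℕ.* (q ℕ.* q)) ℕ.* entries (r ℕ.* N) m ℕ.+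
      (multiplyWork (r ℕ.* N) m ℕ.+ (1 ℕ.+ 3 ℕ.* r) ℕ.* entries N (suc m)))

  length-multiply : ∀ {J N} (e : Fin N ↔ J) m {n t} (ι : Placement J m n t) (ι-injective : Separating {J} {m} ι) →
                    length (multiply e m ι ι-injective) ≡ multiplyWork N m
  length-multiply e zero ι ι-injective = length-tabulate (Leaf.leaf e ι ι-injective ∘ Inverse.to (entry↔ e 0))
  length-multiply {J} e (suc m) ι ι-injective =
    ≡.trans (length-++ downLeft)
    (cong₂ ℕ._+_ (Down.length-linear left (λ ()) (downCoefficient 0F) (downSource left))
    (≡.trans (length-++ downRight)
    (cong₂ ℕ._+_ (Down.length-linear right (λ ()) (downCoefficient 1F) (downSource right))
    (≡.trans (length-++ rest)
    (cong₂ ℕ._+_ (length-multiply (extend↔ e) m (descend {J} {m} ι) (descend-injective ι ι-injective))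
      (Up.length-linear upCoefficient upSource))))))
    where
    open Branch e m ι ι-injective
    rest = multiply (extend↔ e) m (descend {J} {m} ι) (descend-injective ι ι-injective)

  -- Correctness of the recursion

  module Correctness {c ℓ₁ ℓ₂ : Level} (F : HeytingField c ℓ₁ ℓ₂)
    (rank : OverField.Rank≤ F (OverField.⟨_,_,_⟩ F q q q) r) where

    open OverField F
    open Semantics F
    open MatrixAlgebra F

    private
      u v w : Fin r → Fin q × Fin q → Carrier
      u = proj₁ rank
      v = proj₁ (proj₂ rank)
      w = proj₁ (proj₂ (proj₂ rank))

    factor : Fin 3 → Fin r → Fin q × Fin q → Carrier
    factor 0F = u
    factor 1F = v
    factor 2F = w

    γ : Fin constantCount → Carrier
    γ = (λ (f , b) → factorAt f (remQuot {r} (q ℕ.* q) b)) ∘ remQuot {3} (r ℕ.* (q ℕ.* q))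
      where
      factorAt : Fin 3 → Fin r × Fin (q ℕ.* q) → Carrier
      factorAt f (l , y) = factor f l (remQuot q y)

    γ-coefficient : ∀ f l y → γ (coefficient f l y) ≡ factor f l (remQuot q y)
    γ-coefficient f l y = ≡.trans
      (cong (λ (f , b) → factor f (quotient {r} (q ℕ.* q) b) (remQuot q (remainder {r} (q ℕ.* q) b)))
            (Fin.remQuot-combine f (combine l y)))
      (cong (λ (l , y) → factor f l (remQuot q y)) (Fin.remQuot-combine l y))

    matrix : ∀ {J m n t} → Placement J m n t → Memory n t → Array → J → Matrix (q ^ m)
    matrix ι μ α x i j = μ (ι (α , inj₁ (x , i , j)))

    block-product : ∀ {p} (A B : Matrix (q ℕ.* p)) I K →
      ∑[ l < r ] (w l (quotient {q} p K , quotient {q} p I) *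
        (combineBlocks {q} (u l ∘ remQuot q) A · combineBlocks {q} (v l ∘ remQuot q) B)
          (remainder {q} p I) (remainder {q} p K))
      ≈ (A · B) I K
    block-product {p} A B I K = ≈-trans
      (block-product-combine u v w (proj₂ (proj₂ (proj₂ rank))) A B
        (quotient {q} p I) (remainder {q} p I) (quotient {q} p K) (remainder {q} p K))
      (≈-reflexive (cong₂ (A · B) (Fin.combine-remQuot {q} p I) (Fin.combine-remQuot {q} p K)))

    -- Only the `product` array of the current level is described, since the upward pass and the
    -- final copy use no other result of the call. The operands are those in the memory before the
    -- call.
    wp-multiply : ∀ {ℓ J N} (e : Fin N ↔ J) m {n t} (ι : Placement J m n t) (ι-injective : Separating {J} {m} ι)
      {Q : Memory n t → Set ℓ} {μ} →
      (∀ ν → (∀ x i k → matrix {J} {m} ι ν product x i k ≈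
                        (matrix {J} {m} ι μ left x · matrix {J} {m} ι μ right x) i k) → Q ν) →
      wp γ (multiply e m ι ι-injective) Q μ
    wp-multiply {J = J} e zero ι ι-injective {μ = μ} post =
      wp-phase γ (entry↔ e 0) (Leaf.leaf-independent e ι ι-injective)
        (λ (x , i , k) → μ (ι (left , inj₁ (x , i , 0F))) * μ (ι (right , inj₁ (x , 0F , k))))
        (λ _ → mul ≈-refl)
        -- A sum over `Fin 1` unfolds to x + 0#.
        λ ν new _ → post ν λ x i k → ≈-trans (≈-reflexive (new (x , i , k))) (≈-sym (+-identityʳ _))
    wp-multiply {J = J} e (suc m) ι ι-injective {μ = μ} post =
      wp-++ γ downLeft (Down.wp-linear left (λ ()) F γ (downCoefficient 0F) (downSource-fresh left (λ ()) left)
      λ μ₁ newLeft old₁ →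
      wp-++ γ downRight (Down.wp-linear right (λ ()) F γ (downCoefficient 1F) (downSource-fresh right (λ ()) right)
      λ μ₂ newRight old₂ →
      wp-++ γ (multiply (extend↔ e) m ι′ (descend-injective ι ι-injective))
      (wp-multiply (extend↔ e) m ι′ (descend-injective ι ι-injective)
      λ μ₃ newProduct →
      Up.wp-linear F γ upCoefficient upSource-fresh
      λ ν newUp _ → post ν λ x i k → ≈-trans (newUp (x , i , k)) $ ≈-trans
        (sum-cong-≋ λ l → *-cong
          (≈-reflexive (≡.trans (γ-coefficient 2F l _) (cong (w l) (Fin.remQuot-combine _ _))))
          (≈-trans (newProduct (l , x) _ _) (·-cong
            -- The left operands below survive `downRight`, which writes only the arrays `right` and
            -- `scratch` of that level.
            (λ i′ j′ → ≈-trans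
              (≈-reflexive (old₂ _ λ _ → Below.array-distinct (λ ()) , Below.array-distinct (λ ())))
              (≈-trans (newLeft ((l , x) , i′ , j′))
                (sum-cong-≋ λ y → *-congʳ (≈-reflexive (γ-coefficient 0F l y)))))
            -- The right operands of this level are read after `downLeft`, whose writes all lie one
            -- level below.
            (λ i′ j′ → ≈-trans (newRight ((l , x) , i′ , j′))
              (sum-cong-≋ λ y → *-cong (≈-reflexive (γ-coefficient 1F l y))
                (≈-reflexive (old₁ _ (downSource-fresh left (λ ()) right ((l , x) , i′ , j′) y))))) _ _)))
        (block-product (matrix {J} {suc m} ι μ left x) (matrix {J} {suc m} ι μ right x) i k))))
      where
      open Branch e m ι ι-injective
      ι′ = descend {J} {m} ι

-- Costs

module Powers where
  open import Data.Nat.Base using (_+_; _*_)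
  open ℕ.≤-Reasoning

  ^-distribʳ-* : ∀ m n o → (m * n) ^ o ≡ m ^ o * n ^ o
  ^-distribʳ-* m n zero    = refl
  ^-distribʳ-* m n (suc o) = ≡.trans (cong (m * n *_) (^-distribʳ-* m n o))
    (ℕ.[m*n]*[o*p]≡[m*o]*[n*p] m n (m ^ o) (n ^ o))

  ^-swap : ∀ m a b → (m ^ a) ^ b ≡ (m ^ b) ^ a
  ^-swap m a b = ≡.trans (ℕ.^-*-assoc m a b) (≡.trans (cong (m ^_) (ℕ.*-comm a b)) (≡.sym (ℕ.^-*-assoc m b a)))

  -- The power (5/4)^e is traded for 2^d ≤ q^d; the factor 4^e clears the denominators.
  ^-scaled-≤ : ∀ {q s} e d → 2 ≤ q → 4 * s ≤ 5 * (q * q) → 5 ^ e ≤ 4 ^ e * 2 ^ d → s ^ e ≤ q ^ (d + 2 * e)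
  ^-scaled-≤ {q} {s} e d 2≤q scaled 5^e≤ = ℕ.*-cancelˡ-≤ (4 ^ e) {{ℕ.m^n≢0 4 e}} (begin
    4 ^ e * s ^ e                 ≡⟨ ^-distribʳ-* 4 s e ⟨
    (4 * s) ^ e                   ≤⟨ ℕ.^-monoˡ-≤ e scaled ⟩
    (5 * (q * q)) ^ e             ≡⟨ ^-distribʳ-* 5 (q * q) e ⟩
    5 ^ e * (q * q) ^ e           ≤⟨ ℕ.*-monoˡ-≤ ((q * q) ^ e) 5^e≤ ⟩
    4 ^ e * 2 ^ d * (q * q) ^ e   ≡⟨ ℕ.*-assoc (4 ^ e) (2 ^ d) _ ⟩
    4 ^ e * (2 ^ d * (q * q) ^ e) ≤⟨ ℕ.*-monoʳ-≤ (4 ^ e) (ℕ.*-monoˡ-≤ ((q * q) ^ e) (ℕ.^-monoˡ-≤ d 2≤q)) ⟩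
    4 ^ e * (q ^ d * (q * q) ^ e) ≡⟨ cong (λ x → 4 ^ e * (q ^ d * (q * x) ^ e)) (ℕ.*-identityʳ q) ⟨
    4 ^ e * (q ^ d * (q ^ 2) ^ e) ≡⟨ cong (λ x → 4 ^ e * (q ^ d * x)) (ℕ.^-*-assoc q 2 e) ⟩
    4 ^ e * (q ^ d * q ^ (2 * e)) ≡⟨ cong (4 ^ e *_) (ℕ.^-distribˡ-+-* q d (2 * e)) ⟨
    4 ^ e * q ^ (d + 2 * e)       ∎)

  -- The ratio 5/4 is attained at q = 2, where q² + 1 is largest relative to q².
  suc-square-scaled : ∀ {q} → 2 ≤ q → 4 * suc (q * q) ≤ 5 * (q * q)
  suc-square-scaled {q} 2≤q = begin
    4 * suc (q * q)     ≡⟨ ℕ.*-suc 4 (q * q) ⟩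
    4 + 4 * (q * q)     ≤⟨ ℕ.+-monoˡ-≤ (4 * (q * q)) (ℕ.*-mono-≤ 2≤q 2≤q) ⟩
    q * q + 4 * (q * q) ∎

  log-⊔ : ∀ {q r r′ a b} → log[ q ] r ≤ a / b → log[ q ] r′ ≤ a / b → log[ q ] r ℕ.⊔ r′ ≤ a / b
  log-⊔ {q} {r} {r′} {a} {b} log≤ log′≤ with ℕ.⊔-sel r r′
  ... | inj₁ eq = subst (λ x → log[ q ] x ≤ a / b) (≡.sym eq) log≤
  ... | inj₂ eq = subst (λ x → log[ q ] x ≤ a / b) (≡.sym eq) log′≤

  -- 5^1000 ≤ 4^1000 · 2^373 is evaluated; by 2 ≤ q it means (5/4) q² ≤ q^2.373.
  log-scaled : ∀ {q s} → 2 ≤ q → 4 * s ≤ 5 * (q * q) → log[ q ] s ≤ 2373 / 1000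
  log-scaled {q} {s} 2≤q scaled =
    ^-scaled-≤ {q} {s} 1000 373 2≤q scaled (ℕ.≤ᵇ⇒≤ (5 ^ 1000) (4 ^ 1000 * 2 ^ 373) tt)

  coveringPower : ∀ {q} → 2 ≤ q → ∀ n → ∃[ k ] (n ≤ q ^ k × (1 ≤ n → q ^ k ≤ q * n))
  coveringPower         2≤q zero          = 0 , z≤n , λ ()
  coveringPower {suc q} 2≤q (suc zero)    = 0 , ℕ.≤-refl , λ _ → s≤s z≤n
  coveringPower {q}     2≤q (suc n@(suc _)) with k , n≤ , ≤n ← coveringPower 2≤q n | suc n ℕ.≤? q ^ k
  ... | yes sn≤ = k , sn≤ , λ _ → ℕ.≤-trans (≤n (s≤s z≤n)) (ℕ.*-monoʳ-≤ q (ℕ.n≤1+n n))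
  -- The upper bound comes from q^k < n + 1. The lower bound n + 1 ≤ 2n ≤ q q^k needs n ≥ 1, whence
  -- the separate case of size 1.
  ... | no  sn≰ = suc k , larger , λ _ → ℕ.*-monoʳ-≤ q (ℕ.<⇒≤ (ℕ.≰⇒> sn≰))
    where
    larger : suc n ≤ q * q ^ k
    larger = begin
      suc n       ≤⟨ s≤s (ℕ.m≤n+m n _) ⟩
      n + n       ≡⟨ cong (n +_) (ℕ.+-identityʳ n) ⟨
      2 * n       ≤⟨ ℕ.*-mono-≤ 2≤q n≤ ⟩
      q * q ^ k   ∎

  -- Cancelling one factor q leaves 2^(k-1) ≤ q^(k-1) ≤ n; the summand 1 pays for the overshoot of
  -- the padding.
  exponent≤log : ∀ {q k n} → 2 ≤ q → q ^ k ≤ q * n → k ≤ 1 + ⌊log₂ n ⌋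
  exponent≤log         {k = zero}  2≤q _  = z≤n
  exponent≤log {suc q} {suc k} {n} 2≤q ≤n = s≤s (begin
    k              ≡⟨ ⌊log₂[2^n]⌋≡n k ⟨
    ⌊log₂ 2 ^ k ⌋  ≤⟨ ⌊log₂⌋-mono-≤ (ℕ.≤-trans (ℕ.^-monoˡ-≤ k 2≤q) (ℕ.*-cancelˡ-≤ (suc q) ≤n)) ⟩
    ⌊log₂ n ⌋      ∎)

  m≤m^n : ∀ m n .{{_ : NonZero n}} → m ≤ m ^ n
  m≤m^n zero      n         = z≤n
  m≤m^n m@(suc _) (suc n)   = ℕ.m≤m*n m (m ^ n) {{ℕ.m^n≢0 m n}}

  power-bound : ∀ {q r a b c} .{{_ : NonZero b}} {f k : ℕ → ℕ} → r ^ b ≤ q ^ a →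
                (∀ n → 1 ≤ n → q ^ k n ≤ q * n) → (∀ n → 1 ≤ n → f n ≤ c * r ^ k n) →
                f ∈O[n^ a / b ]
  -- The sharper constant c q^(a/b) need not be natural; c q^a replaces it, using q^a ≤ (q^a)^b. The
  -- threshold 1 excludes n = 0, where no upper bound on q^k is given.
  power-bound {q} {r} {a} {b} {c} {f = f} {k} r^b≤ q^k≤ f≤ = c * q ^ a , 1 , λ n 1≤n → begin
    f n ^ b                       ≤⟨ ℕ.^-monoˡ-≤ b (f≤ n 1≤n) ⟩
    (c * r ^ k n) ^ b             ≡⟨ ^-distribʳ-* c (r ^ k n) b ⟩
    c ^ b * (r ^ k n) ^ b         ≡⟨ cong (c ^ b *_) (^-swap r (k n) b) ⟩
    c ^ b * (r ^ b) ^ k n         ≤⟨ ℕ.*-monoʳ-≤ (c ^ b) (ℕ.^-monoˡ-≤ (k n) r^b≤) ⟩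
    c ^ b * (q ^ a) ^ k n         ≡⟨ cong (c ^ b *_) (^-swap q a (k n)) ⟩
    c ^ b * (q ^ k n) ^ a         ≤⟨ ℕ.*-monoʳ-≤ (c ^ b) (ℕ.^-monoˡ-≤ a (q^k≤ n 1≤n)) ⟩
    c ^ b * (q * n) ^ a           ≡⟨ cong (c ^ b *_) (^-distribʳ-* q n a) ⟩
    c ^ b * (q ^ a * n ^ a)       ≤⟨ ℕ.*-monoʳ-≤ (c ^ b) (ℕ.*-monoˡ-≤ (n ^ a) (m≤m^n (q ^ a) b)) ⟩
    c ^ b * ((q ^ a) ^ b * n ^ a) ≡⟨ ℕ.*-assoc (c ^ b) _ _ ⟨
    c ^ b * (q ^ a) ^ b * n ^ a   ≡⟨ cong (_* n ^ a) (^-distribʳ-* c (q ^ a) b) ⟨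
    (c * q ^ a) ^ b * n ^ a       ∎

module Costs {q r : ℕ} where
  open import Data.Nat.Base using (_+_; _*_)
  open ℕ.≤-Reasoning
  open Recursion q r

  module _ (q²<r : suc (q * q) ≤ r) where

    -- The two sides are q² + 1 and r times N q^(2m); this is where strictness of q² < r acts.
    entries-step : ∀ N m → entries N m + entries N (suc m) ≤ r * N * (q ^ m * q ^ m)
    entries-step N m = begin
      N * s + N * (q * q ^ m * (q * q ^ m))  ≡⟨ rearrange N q (q ^ m) ⟩
      suc (q * q) * (N * s)                  ≤⟨ ℕ.*-monoˡ-≤ (N * s) q²<r ⟩
      r * (N * s)                            ≡⟨ ℕ.*-assoc r N s ⟨
      r * N * s                              ∎
      where
      s = q ^ m * q ^ m
      rearrange : ∀ N q x → N * (x * x) + N * (q * x * (q * x)) ≡ suc (q * q) * (N * (x * x))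
      rearrange = solve-∀

    -- slots N m = N Σ_{i≤m} r^i s^(m-i) with s = q²; the extra summand N s^(m+1)
    -- comes from (r - s) Σ r^i s^(m-i) = r^(m+1) - s^(m+1) and 1 ≤ r - s.
    slots-geometric : ∀ N m → slots N m + entries N (suc m) ≤ N * r ^ suc m
    slots-geometric N zero = begin
      entries N 0 + 0 + entries N 1  ≡⟨ cong (_+ entries N 1) (ℕ.+-identityʳ (entries N 0)) ⟩
      entries N 0 + entries N 1      ≤⟨ entries-step N 0 ⟩
      r * N * 1                      ≡⟨ rearrange r N ⟩
      N * (r * 1)                    ∎
      where
      rearrange : ∀ r N → r * N * 1 ≡ N * (r * 1)
      rearrange = solve-∀
    slots-geometric N (suc m) = begin
      entries N (suc m) + slots (r * N) m + entries N (suc (suc m))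
        ≡⟨ rearrange₁ (entries N (suc m)) _ _ ⟩
      slots (r * N) m + (entries N (suc m) + entries N (suc (suc m)))
        -- The top level and the extra summand together fit into the extra summand of the induction
        -- hypothesis for r * N and m.
        ≤⟨ ℕ.+-monoʳ-≤ (slots (r * N) m) (entries-step N (suc m)) ⟩
      slots (r * N) m + entries (r * N) (suc m)
        ≤⟨ slots-geometric (r * N) m ⟩
      r * N * r ^ suc m
        ≡⟨ rearrange₂ r N (r ^ suc m) ⟩
      N * (r * r ^ suc m) ∎
      where
      rearrange₁ : ∀ x y z → x + y + z ≡ y + (x + z)
      rearrange₁ = solve-∀
      rearrange₂ : ∀ r N x → r * N * x ≡ N * (r * x)
      rearrange₂ = solve-∀

    slots≤ : ∀ m → slots 1 m ≤ r * r ^ m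
    slots≤ m = begin
      slots 1 m                       ≤⟨ ℕ.m≤m+n _ _ ⟩
      slots 1 m + entries 1 (suc m)   ≤⟨ slots-geometric 1 m ⟩
      1 * r ^ suc m                   ≡⟨ ℕ.*-identityˡ _ ⟩
      r * r ^ m                       ∎

  downCost upCost : ℕ
  downCost = 1 + 3 * (q * q)
  upCost   = 1 + 3 * r

  -- The second summand charges the filling of the top level, so that every
  -- level pays for one downward and one upward pass over its entries.
  multiplyWork≤ : ∀ N m → multiplyWork N m + (downCost + downCost) * entries N m ≤
                          (upCost + (downCost + downCost)) * slots N m
  multiplyWork≤ N zero = begin
    suc (downCost + downCost) * entries N 0
      ≤⟨ ℕ.*-mono-≤ (ℕ.+-monoˡ-≤ (downCost + downCost) {1} {upCost} (s≤s z≤n)) (ℕ.m≤m+n (entries N 0) 0) ⟩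
    (upCost + (downCost + downCost)) * slots N 0 ∎
  multiplyWork≤ N (suc m) = begin
    downCost * E′ + (downCost * E′ + (multiplyWork (r * N) m + upCost * E)) + (downCost + downCost) * E
      ≡⟨ rearrange downCost upCost E E′ (multiplyWork (r * N) m) ⟩
    (upCost + (downCost + downCost)) * E + (multiplyWork (r * N) m + (downCost + downCost) * E′)
      ≤⟨ ℕ.+-monoʳ-≤ ((upCost + (downCost + downCost)) * E) (multiplyWork≤ (r * N) m) ⟩
    (upCost + (downCost + downCost)) * E + (upCost + (downCost + downCost)) * slots (r * N) m
      ≡⟨ ℕ.*-distribˡ-+ (upCost + (downCost + downCost)) E _ ⟨
    (upCost + (downCost + downCost)) * slots N (suc m) ∎
    where
    E  = entries N (suc m)
    E′ = entries (r * N) m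
    rearrange : ∀ d u e e′ w → d * e′ + (d * e′ + (w + u * e)) + (d + d) * e ≡
                               (u + (d + d)) * e + (w + (d + d) * e′)
    rearrange = solve-∀

  levelDepth : ℕ
  levelDepth = downCost + (downCost + upCost)

  multiplyDepth≡ : ∀ m → multiplyDepth m ≡ 1 + m * levelDepth
  multiplyDepth≡ zero    = refl
  multiplyDepth≡ (suc m) = ≡.trans
    (cong (λ x → downCost + (downCost + (x + upCost))) (multiplyDepth≡ m))
    (rearrange downCost upCost (m * levelDepth))
    where
    rearrange : ∀ d u x → d + (d + (1 + x + u)) ≡ 1 + (d + (d + u) + x)
    rearrange = solve-∀

-- The algorithm

module Implementation (q r : ℕ) (exponent : ℕ → ℕ) (n≤q^k : ∀ n → n ≤ q ^ exponent n) where

  open Recursion q r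

  temporaryCount : ℕ → ℕ
  temporaryCount n = 4 ℕ.* slots 1 (exponent n)

  module _ (n : ℕ) where

    private
      k = exponent n
      t′ = temporaryCount n

    J : Set
    J = Fin 1

    e : Fin 1 ↔ J
    e = ↔-refl

    temporaries↔ : (Array × Slot J k) ↔ Fin t′
    temporaries↔ = ↔-sym (↔-trans Fin.*↔× (↔-refl ×-↔ slot↔ e k))

    ι : Placement J k n t′
    ι s = temp (Inverse.to temporaries↔ s)

    ι-injective : Separating {J} {k} ι
    ι-injective eq = to-injective temporaries↔ (temp-injective eq)
      where
      temp-injective : ∀ {x y} → temp {n} {t′} x ≡ temp y → x ≡ y
      temp-injective refl = refl

    open Entries {J} {k} ι ι-injective

    -- A padding index has no source cell; `Copying` turns `nothing` into zero, in agreement with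
    -- `pad`.
    paddedCell : (Fin n → Fin n → Cell n t′) → Entry J k → Maybe (Cell n t′)
    paddedCell mat (_ , i , j) = Maybe.map (uncurry mat) (Maybe.zip (lower n i) (lower n j))

    paddedCell-fresh : ∀ mat → (∀ {i j y} → temp y ≢ mat i j) →
                       ∀ α a b {x} → paddedCell mat a ≡ just x → entry α b ≢ x
    paddedCell-fresh mat temp≢ α (_ , i , j) b eq with Maybe.zip (lower n i) (lower n j) | eq
    ... | just _ | refl = temp≢

    module Load (α : Array) = Copying {constantCount} (entry↔ e k) (entry α) (entry-injective α)

    productCell : Fin n × Fin n → Maybe (Cell n t′)
    productCell (i , j) = just (entry product (0F , inject≤ i (n≤q^k n) , inject≤ j (n≤q^k n)))

    productCell-fresh : ∀ a b {x} → productCell a ≡ just x → uncurry matC b ≢ x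
    productCell-fresh _ _ refl ()

    matC-injective : ∀ {a b} → uncurry (matC {n} {t′}) a ≡ uncurry matC b → a ≡ b
    matC-injective refl = refl

    module Store = Copying {constantCount} Fin.*↔× (uncurry matC) matC-injective

    loadLeft loadRight core store strassen : Program constantCount n t′
    loadLeft  = Load.copy left (paddedCell matA)
    loadRight = Load.copy right (paddedCell matB)
    core      = multiply e k ι ι-injective
    store     = Store.copy productCell
    strassen  = loadLeft ++ loadRight ++ core ++ store

    Depth≤-strassen : Depth≤ strassen (2 ℕ.+ (2 ℕ.+ (multiplyDepth k ℕ.+ 2)))
    Depth≤-strassen =
      Depth≤-++ loadLeft (Load.Depth≤-copy left (paddedCell matA) (paddedCell-fresh matA (λ ()) left))
      (Depth≤-++ loadRight (Load.Depth≤-copy right (paddedCell matB) (paddedCell-fresh matB (λ ()) right))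
      (Depth≤-++ core (Depth≤-multiply e k ι ι-injective)
      (Store.Depth≤-copy productCell productCell-fresh)))

    length-strassen : length strassen ≡
      (entries 1 k ℕ.+ entries 1 k) ℕ.+
      ((entries 1 k ℕ.+ entries 1 k) ℕ.+ (multiplyWork 1 k ℕ.+ (n ℕ.* n ℕ.+ n ℕ.* n)))
    length-strassen =
      ≡.trans (length-++ loadLeft) (cong₂ ℕ._+_ (Load.length-copy left (paddedCell matA))
      (≡.trans (length-++ loadRight) (cong₂ ℕ._+_ (Load.length-copy right (paddedCell matB))
      (≡.trans (length-++ core) (cong₂ ℕ._+_ (length-multiply e k ι ι-injective) (Store.length-copy productCell))))))

    module _ {c ℓ₁ ℓ₂ : Level} (F : HeytingField c ℓ₁ ℓ₂)
      (rank : OverField.Rank≤ F (OverField.⟨_,_,_⟩ F q q q) r) where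

      open OverField F
      open Semantics F
      open MatrixAlgebra F
      open Correctness F rank

      loaded : ∀ {μ : Memory n t′} {A : Matrix n} {mat} → (∀ i j → μ (mat i j) ≈ A i j) →
               ∀ i j → maybe μ 0# (paddedCell mat (0F , i , j)) ≈ pad A i j
      loaded μ≈A i j with Maybe.zip (lower n i) (lower n j)
      ... | just (i′ , j′) = μ≈A i′ j′
      ... | nothing        = ≈-refl

      wp-strassen : ∀ {A B : Matrix n} {μ} →
                    (∀ i j → μ (matA i j) ≈ A i j) → (∀ i j → μ (matB i j) ≈ B i j) →
                    wp γ strassen (λ ν → ∀ i j → ν (matC i j) ≈ (A · B) i j) μ
      wp-strassen {A} {B} μ≈A μ≈B =
        wp-++ γ loadLeft (Load.wp-copy left (paddedCell matA) (paddedCell-fresh matA (λ ()) left) F γ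
        λ μ₁ new₁ old₁ →
        wp-++ γ loadRight (Load.wp-copy right (paddedCell matB) (paddedCell-fresh matB (λ ()) right) F γ
        λ μ₂ new₂ old₂ →
        wp-++ γ core (wp-multiply e k ι ι-injective
        λ μ₃ new₃ →
        Store.wp-copy productCell productCell-fresh F γ
        λ ν new₄ _ i j → ≈-trans (new₄ (i , j)) $ ≈-trans (new₃ 0F _ _) $ ≈-trans
          (·-cong
            (λ i j → ≈-trans (≈-reflexive (old₂ _ λ b → array-distinct {right} {left} (λ ()) {b} {0F , i , j}))
                     (≈-trans (new₁ (0F , i , j)) (loaded {mat = matA} μ≈A i j)))
            (λ i j → ≈-trans (new₂ (0F , i , j))
                     (loaded {mat = matB} (λ i j → ≈-trans (≈-reflexive (old₁ _ λ _ ())) (μ≈B i j)) i j))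
            _ _)
          (pad-· (n≤q^k n) A B i j))))

  algorithm : ParallelAlgorithm
  algorithm = record { constants = constantCount ; temporaries = temporaryCount ; program = strassen }

  algorithm-correct : ∀ {c ℓ₁ ℓ₂} (F : HeytingField c ℓ₁ ℓ₂) → let open OverField F in
                      Rank≤ ⟨ q , q , q ⟩ r → MultipliesMatrices algorithm
  algorithm-correct F rank = γ , λ n A B μ μ≈A μ≈B → wp⇒Run γ (strassen n) (wp-strassen n F rank μ≈A μ≈B)
    where
    open Semantics F
    open Correctness F rank

  -- Asymptotic bounds

  module Asymptotics (2≤q : 2 ≤ q) (q²<r : suc (q ℕ.* q) ≤ r)
                     (q^k≤q*n : ∀ n → 1 ≤ n → q ^ exponent n ≤ q ℕ.* n) where
    open import Data.Nat.Base using (_+_; _*_)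
    open ℕ.≤-Reasoning
    open Powers
    open Costs {q} {r}
    open ParallelAlgorithm algorithm

    n*n≤slots : ∀ n → n * n ≤ slots 1 (exponent n)
    n*n≤slots n = begin
      n * n                    ≤⟨ ℕ.*-mono-≤ (n≤q^k n) (n≤q^k n) ⟩
      p * p                    ≡⟨ ℕ.*-identityˡ (p * p) ⟨
      entries 1 (exponent n)   ≤⟨ ℕ.m≤m+n _ _ ⟩
      slots 1 (exponent n)     ∎
      where p = q ^ exponent n

    -- The 6 counts copying phases, two each for loading A, loading B and storing the product; none
    -- is longer than the number of slots.
    work≤ : ∀ n → work n ≤ (6 + (upCost + (downCost + downCost))) * r * r ^ exponent n
    work≤ n = begin
      work n                                 ≡⟨ length-strassen n ⟩
      (E + E) + ((E + E) + (W + (n * n + n * n)))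
        ≤⟨ ℕ.+-mono-≤ (ℕ.+-mono-≤ E≤ E≤) (ℕ.+-mono-≤ (ℕ.+-mono-≤ E≤ E≤)
             (ℕ.+-mono-≤ (ℕ.≤-trans (ℕ.m≤m+n W _) (multiplyWork≤ 1 k))
               (ℕ.+-mono-≤ (n*n≤slots n) (n*n≤slots n)))) ⟩
      (S + S) + ((S + S) + (c * S + (S + S))) ≡⟨ rearrange S c ⟩
      (6 + c) * S                             ≤⟨ ℕ.*-monoʳ-≤ (6 + c) (slots≤ q²<r k) ⟩
      (6 + c) * (r * r ^ k)                   ≡⟨ ℕ.*-assoc (6 + c) r (r ^ k) ⟨
      (6 + c) * r * r ^ k                     ∎
      where
      k = exponent n
      E = entries 1 k
      S = slots 1 k
      W = multiplyWork 1 k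
      c = upCost + (downCost + downCost)
      E≤ : E ≤ S
      E≤ = ℕ.m≤m+n _ _
      rearrange : ∀ s c → (s + s) + ((s + s) + (c * s + (s + s))) ≡ (6 + c) * s
      rearrange = solve-∀

    -- 7 = 3 + 4: three n × n matrices, each no larger than the number of slots, and four arrays of
    -- temporaries.
    space≤ : ∀ n → space n ≤ 7 * r * r ^ exponent n
    space≤ n = begin
      3 * (n * n) + 4 * S  ≤⟨ ℕ.+-monoˡ-≤ (4 * S) (ℕ.*-monoʳ-≤ 3 (n*n≤slots n)) ⟩
      3 * S + 4 * S        ≡⟨ ℕ.*-distribʳ-+ S 3 4 ⟨
      7 * S                ≤⟨ ℕ.*-monoʳ-≤ 7 (slots≤ q²<r (exponent n)) ⟩
      7 * (r * r ^ exponent n)  ≡⟨ ℕ.*-assoc 7 r _ ⟨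
      7 * r * r ^ exponent n    ∎
      where S = slots 1 (exponent n)

    depth : ℕ → ℕ
    depth n = 2 + (2 + (multiplyDepth (exponent n) + 2))

    depth∈O : depth ∈O[log-n]
    -- From n = 2 on the logarithm is at least 1 and so absorbs both the 7 (six copying phases and
    -- the leaf) and the extra level from `exponent≤log`.
    depth∈O = 7 + (levelDepth + levelDepth) , 2 , λ n 2≤n →
      let l = ⌊log₂ n ⌋
          1≤l = ⌊log₂⌋-mono-≤ 2≤n
      in begin
      4 + (multiplyDepth (exponent n) + 2)    ≡⟨ cong (λ x → 4 + (x + 2)) (multiplyDepth≡ (exponent n)) ⟩
      4 + (1 + exponent n * levelDepth + 2)   ≡⟨ rearrange₁ (exponent n * levelDepth) ⟩
      7 + exponent n * levelDepth
        ≤⟨ ℕ.+-monoʳ-≤ 7 (ℕ.*-monoˡ-≤ levelDepth 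
             (exponent≤log {q} {exponent n} 2≤q (q^k≤q*n n (ℕ.≤-trans (s≤s z≤n) 2≤n)))) ⟩
      7 + (1 + l) * levelDepth
        ≤⟨ ℕ.+-mono-≤ (ℕ.*-monoʳ-≤ 7 1≤l) (ℕ.*-monoˡ-≤ levelDepth (ℕ.+-monoˡ-≤ l 1≤l)) ⟩
      7 * l + (l + l) * levelDepth            ≡⟨ rearrange₂ l levelDepth ⟩
      (7 + (levelDepth + levelDepth)) * l     ∎
      where
      rearrange₁ : ∀ x → 4 + (1 + x + 2) ≡ 7 + x
      rearrange₁ = solve-∀
      rearrange₂ : ∀ l d → 7 * l + (l + l) * d ≡ (7 + (d + d)) * l
      rearrange₂ = solve-∀

corollary6p19 : {c ℓ₁ ℓ₂ : Level} (F : HeytingField c ℓ₁ ℓ₂) →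
    let open OverField F in
    (q r : ℕ) → 2 ≤ q → Rank≤ ⟨ q , q , q ⟩ r → log[ q ] r ≤ 2373 / 1000 →
    ∃[ alg ] (
    let open ParallelAlgorithm alg in
    MultipliesMatrices alg ×
    work ∈O[n^ 2373 / 1000 ] ×
    (∃[ depth ] (HasDepthBound depth × depth ∈O[log-n])) ×
    space ∈O[n^ 2373 / 1000 ])
corollary6p19 F q r 2≤q rank log≤ =
  algorithm ,
  algorithm-correct F (Rank≤-mono {T = ⟨ q , q , q ⟩} (ℕ.≤⇒≤′ (ℕ.m≤m⊔n r (suc (q ℕ.* q)))) rank) ,
  power-bound {q} {r′} {2373} {1000} {(6 ℕ.+ (upCost ℕ.+ (downCost ℕ.+ downCost))) ℕ.* r′}
    {f = work} {exponent} log′≤ q^k≤q*n (λ n _ → work≤ n) ,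
  (depth , Depth≤-strassen , depth∈O) ,
  power-bound {q} {r′} {2373} {1000} {7 ℕ.* r′} {f = space} {exponent} log′≤ q^k≤q*n (λ n _ → space≤ n)
  where
  open OverField F
  open MatrixAlgebra F
  open Powers
  -- The maximum secures q² < r′ and keeps the exponent, since both arguments satisfy the
  -- logarithmic bound.
  r′ = r ℕ.⊔ suc (q ℕ.* q)
  exponent = λ n → proj₁ (coveringPower 2≤q n)
  q^k≤q*n = λ n → proj₂ (proj₂ (coveringPower 2≤q n))
  open Implementation q r′ exponent (λ n → proj₁ (proj₂ (coveringPower 2≤q n)))
  open Costs {q} {r′} using (upCost; downCost)
  open Asymptotics 2≤q (ℕ.m≤n⊔m r (suc (q ℕ.* q))) q^k≤q*n
  open ParallelAlgorithm algorithm
  log′≤ : log[ q ] r′ ≤ 2373 / 1000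
  log′≤ = log-⊔ {q} {r} {suc (q ℕ.* q)} {2373} {1000} log≤
    (log-scaled {q} {suc (q ℕ.* q)} 2≤q (suc-square-scaled 2≤q))
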